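{- Let $\tau$ be a vocabulary and let $\phi(\bar{x},\bar{\kappa})$ be an $\mathsf{LREC}_=[\tau]$-formula, where $\bar{x}$ is a tuple of domain variables, $\bar{\kappa}$ is a tuple of number variables, and the free variables of $\phi$ are among $\bar{x}\bar{\kappa}$. Then there are a constant $k\in\mathbb{N}$ and a function $f\in O(\log n)$ such that for every $n\in\mathbb{N}$ there is a family $\bigl(\psi_{\bar{m}}(\bar{x})\bigr)_{\bar{m}\in[n]^{|\bar{\kappa}|}}$ of $\mathsf{C}^k[\tau]$-formulae, each of quantifier depth at most $f(n)$, such that for all $\tau$-structures $\mathcal{A}$ with $|\mathcal{A}|\le n$, all $\bar{v}\in V(\mathcal{A})^{|\bar{x}|}$ and all $\bar{m}\in[|\mathcal{A}|]^{|\bar{\kappa}|}$: \[\mathcal{A}^+\models\phi(\bar{v},\bar{m})\iff \mathcal{A}\models\psi_{\bar{m}}(\bar{v}).\]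
   Context: A vocabulary is a non-empty finite set of relation symbols with arities; a $\tau$-structure $\mathcal{A}$ has a finite non-empty domain $V(\mathcal{A})$ and relations $R(\mathcal{A})\subseteq V(\mathcal{A})^{a_R}$; $|\mathcal{A}|=|V(\mathcal{A})|$; $[m]=\{1,\dots,m\}$. Two-sorted structure: $\mathcal{A}^+=(V(\mathcal{A}),(R(\mathcal{A}))_{R\in\tau},N(\mathcal{A}),\le,S,\min,\max)$ with number sort $N(\mathcal{A})=\{0,\dots,|\mathcal{A}|\}$, its natural linear order $\le$, successor relation $S$ and unary singleton relations $\min,\max$. Domain variables range over $V(\mathcal{A})$, number variables over $N(\mathcal{A})$. A tuple $\bar{i}\in N(\mathcal{A})^\ell$ denotes the number $\langle\bar{i}\rangle_{\mathcal{A}}=\sum_{j=1}^{\ell}\bar{i}_j(|\mathcal{A}|+1)^{j-1}$. $\mathsf{FO{+}C}$ is first-order logic over such two-sorted structures (quantification over both sorts), extended by formulae $\#x\,\phi=\kappa$ and $\#\iota\,\phi=\kappa$ ($x$ a domain variable, $\iota,\kappa$ number variables), true under an assignment $\alpha$ iff the number of $v\in V(\mathcal{A})$ (resp. $i\in N(\mathcal{A})$) satisfying $\phi$ when assigned to $x$ (resp. $\iota$) equals $\alpha(\kappa)$. $\mathsf{LREC}_=$ extends the syntax of $\mathsf{FO{+}C}$ by the rule: if $\bar{y}_1,\bar{y}_2,\bar{x}$ are $k$-tuples of domain variables, $\bar{\iota},\bar{\kappa}$ non-empty tuples of number variables and $\phi_=,\phi_E,\phi_C$ are $\mathsf{LREC}_=$-formulae,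 then $\phi=[\mathrm{lrec}_{\bar{y}_1,\bar{y}_2,\bar{\iota}}\,\phi_=,\phi_E,\phi_C](\bar{x},\bar{\kappa})$ is a formula (in it $\bar{y}_1,\bar{y}_2$ are bound in $\phi_=,\phi_E$, and $\bar{y}_1,\bar{\iota}$ are bound in $\phi_C$; $\bar x,\bar\kappa$ are free). Semantics on $\mathcal{A}^+$ with assignment $\alpha$ (other free variables fixed by $\alpha$): let $G'$ be the directed graph on $V(\mathcal{A})^k$ whose edges are the pairs $(\bar{v}_1,\bar{v}_2)$ satisfying $\phi_E$ with $\bar{v}_1,\bar{v}_2$ assigned to $\bar{y}_1,\bar{y}_2$; let $\sim$ be the equivalence relation on $V(\mathcal{A})^k$ defined by $\phi_=(\bar y_1,\bar y_2)$; let $G$ be the quotient graph with vertex set $V(\mathcal{A})^k/{\sim}$ and an edge from class $[\bar{v}_1]$ to $[\bar{v}_2]$ iff $(\bar v_1',\bar v_2')\in E(G')$ for some members of these classes. For a class $c$, let $C(c)=\{\langle\bar{i}\rangle_{\mathcal{A}}:\bar{i}\in N(\mathcal{A})^{|\bar{\iota}|}$, and $\phi_C$ holds with some $\bar{v}'\in c$ assigned to $\bar{y}_1$ and $\bar{i}$ to $\bar{\iota}\}$. Let $X$ be the set of pairs $(c,i)$ ($c$ a vertex of $G$, $i\in\mathbb{N}$) defined recursively by: $(c,i)\in X$ iff $i>0$ and $\bigl|\{d\in N^+_G(c): (d,\lfloor (i-1)/\deg^-_G(d)\rfloor)\in X\}\bigr|\in C(c)$. Then $(\mathcal{A}^+,\alpha)\models\phi$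 iff $([\alpha(\bar{x})],\langle\alpha(\bar{\kappa})\rangle_{\mathcal{A}})\in X$. $\mathsf{C}$ is first-order logic (over ordinary one-sorted $\tau$-structures) extended by counting quantifiers $\exists^{\ge m}x\,\psi$ for all $m\in\mathbb{N}$; $\mathsf{C}^k$ is its fragment using only the variables $x_1,\dots,x_k$ (which may be reused). Quantifier depth is the maximal nesting of (counting) quantifiers. -}

module Defs where

open import Data.Nat using (ℕ; zero; suc; _+_; _*_; _≤_; _<_; _⊔_; _≡ᵇ_; _≤ᵇ_; _/_)
open import Data.Nat.Logarithm using (⌊log₂_⌋)
open import Data.Bool using (Bool; true; false; _∧_; _∨_; not; if_then_else_)
open import Data.Fin using (Fin; toℕ)
import Data.Fin as F
open import Data.List using (List; []; _∷_; [_]; concatMap; length; allFin)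
open import Data.Bool.ListAction using (any)
import Data.List as L
open import Data.Vec using (Vec; []; _∷_; lookup; _++_; _[_]≔_)
import Data.Vec as V
open import Data.Vec.Properties using (≡-dec)
open import Data.Product using (Σ; _×_; _,_)
open import Relation.Nullary.Decidable using (⌊_⌋)

-- A vocabulary: finitely many relation symbols (indexed by Fin nsym),
-- each with an arity.  (Non-emptiness is a hypothesis of the theorem.)
record Vocab : Set where
  field
    nsym  : ℕ
    arity : Fin nsym → ℕ
open Vocab public

-- A τ-structure with domain Fin s (so |A| = s).  Relations are given by
-- their (decidable) characteristic functions.  Non-emptiness (1 ≤ s) is a
-- hypothesis wherever structures are quantified.
record Structure (τ : Vocab) (s : ℕ) : Set where
  field
    relA : (R : Fin (nsym τ)) → Vec (Fin s) (arity τ R) → Bool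
open Structure public

countL : {A : Set} → (A → Bool) → List A → ℕ
countL p [] = 0
countL p (x ∷ xs) = (if p x then 1 else 0) + countL p xs

tuples : ∀ s k → List (Vec (Fin s) k)
tuples s zero = [ [] ]
tuples s (suc k) = concatMap (λ v → L.map (v ∷_) (tuples s k)) (allFin s)

vecEq : ∀ {s k} → Vec (Fin s) k → Vec (Fin s) k → Bool
vecEq u v = ⌊ ≡-dec F._≟_ u v ⌋

encode : ∀ {s ℓ} → Vec (Fin (suc s)) ℓ → ℕ
encode [] = 0
encode {s} (i ∷ is) = toℕ i + suc s * encode is

-- division, only ever used with non-zero divisor (in-degree of a successor)
divOr0 : ℕ → ℕ → ℕ
divOr0 j zero = 0
divOr0 j (suc d) = j / suc d

-- Semantics of the lrec operator, given the (already evaluated) formulas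
--   eq : φ_=(ȳ₁,ȳ₂), E : φ_E(ȳ₁,ȳ₂), C : φ_C(ȳ₁,ῑ)
-- on a domain Fin s, for k-tuples and |ῑ| = ℓ.

module LRecSem (s k ℓ : ℕ)
  (eq E : Vec (Fin s) k → Vec (Fin s) k → Bool)
  (C : Vec (Fin s) k → Vec (Fin (suc s)) ℓ → Bool) where

  T : List (Vec (Fin s) k)
  T = tuples s k

  -- equivalence relation ∼ generated by φ_= (coincides with φ_= when
  -- φ_= already defines an equivalence relation); path search with fuel.
  reach : ℕ → Vec (Fin s) k → Vec (Fin s) k → Bool
  reach zero u v = vecEq u v
  reach (suc f) u v = vecEq u v ∨ any (λ w → (eq u w ∨ eq w u) ∧ reach f w v) T

  sim : Vec (Fin s) k → Vec (Fin s) k → Bool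
  sim = reach (length T)

  -- edge relation of the quotient graph G, on representatives
  edgeG : Vec (Fin s) k → Vec (Fin s) k → Bool
  edgeG u v = any (λ u' → sim u u' ∧ any (λ v' → sim v v' ∧ E u' v') T) T

  -- number of ∼-classes satisfying a class-invariant predicate
  -- (each class is counted at its last occurrence in T)
  countClasses : (Vec (Fin s) k → Bool) → ℕ
  countClasses P = go T
    where
    go : List (Vec (Fin s) k) → ℕ
    go [] = 0
    go (w ∷ ws) = (if P w ∧ not (any (sim w) ws) then 1 else 0) + go ws

  indeg : Vec (Fin s) k → ℕ
  indeg v = countClasses (λ w → edgeG w v)

  inC : Vec (Fin s) k → ℕ → Bool
  inC u j = any (λ is → (encode is ≡ᵇ j) ∧ any (λ u' → sim u u' ∧ C u' is) T)
                (tuples (suc s) ℓ)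

  -- X restricted by fuel: Xf f u i = [([u], i) ∈ X] whenever i ≤ f
  Xf : ℕ → Vec (Fin s) k → ℕ → Bool
  Xf zero u i = false
  Xf (suc f) u zero = false
  Xf (suc f) u (suc j) =
    inC u (countClasses (λ w → edgeG u w ∧ Xf f w (divOr0 j (indeg w))))

  X : Vec (Fin s) k → ℕ → Bool
  X u i = Xf i u i

-- Syntax of LREC_= [τ], well-scoped: LF τ d n has its free domain
-- variables among Fin d and free number variables among Fin n.
-- Newly bound variables are placed in front.

data LF (τ : Vocab) : ℕ → ℕ → Set where
  rel   : ∀ {d n} (R : Fin (nsym τ)) → Vec (Fin d) (arity τ R) → LF τ d n
  deq   : ∀ {d n} → Fin d → Fin d → LF τ d n
  neq   : ∀ {d n} → Fin n → Fin n → LF τ d n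
  nle   : ∀ {d n} → Fin n → Fin n → LF τ d n
  nsucc : ∀ {d n} → Fin n → Fin n → LF τ d n
  nmin  : ∀ {d n} → Fin n → LF τ d n
  nmax  : ∀ {d n} → Fin n → LF τ d n
  lnot  : ∀ {d n} → LF τ d n → LF τ d n
  land  : ∀ {d n} → LF τ d n → LF τ d n → LF τ d n
  lor   : ∀ {d n} → LF τ d n → LF τ d n → LF τ d n
  exD   : ∀ {d n} → LF τ (suc d) n → LF τ d n
  exN   : ∀ {d n} → LF τ d (suc n) → LF τ d n
  cntD  : ∀ {d n} → LF τ (suc d) n → Fin n → LF τ d n
  cntN  : ∀ {d n} → LF τ d (suc n) → Fin n → LF τ d n
  -- [lrec_{ȳ₁,ȳ₂,ῑ} φ_=, φ_E, φ_C](x̄, κ̄) with |ȳᵢ| = |x̄| = k,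
  -- |ῑ| = suc ℓ, |κ̄| = suc m.  In φ_=, φ_E the variables ȳ₁ ȳ₂ come
  -- first (ȳ₁ then ȳ₂); in φ_C, ȳ₁ and ῑ come first.
  lrec  : ∀ {d n} (k ℓ m : ℕ) →
          LF τ ((k + k) + d) n → LF τ ((k + k) + d) n →
          LF τ (k + d) (suc ℓ + n) →
          Vec (Fin d) k → Vec (Fin n) (suc m) → LF τ d n

-- Semantics on A⁺: domain Fin s, number sort Fin (suc s) = {0,…,s}.
eval : ∀ {τ s d n} → Structure τ s → LF τ d n →
       Vec (Fin s) d → Vec (Fin (suc s)) n → Bool
eval A (rel R xs) α β = relA A R (V.map (lookup α) xs)
eval A (deq x y) α β = ⌊ lookup α x F.≟ lookup α y ⌋
eval A (neq i j) α β = ⌊ lookup β i F.≟ lookup β j ⌋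
eval A (nle i j) α β = toℕ (lookup β i) ≤ᵇ toℕ (lookup β j)
eval A (nsucc i j) α β = suc (toℕ (lookup β i)) ≡ᵇ toℕ (lookup β j)
eval A (nmin i) α β = toℕ (lookup β i) ≡ᵇ 0
eval {s = s} A (nmax i) α β = toℕ (lookup β i) ≡ᵇ s
eval A (lnot φ) α β = not (eval A φ α β)
eval A (land φ ψ) α β = eval A φ α β ∧ eval A ψ α β
eval A (lor φ ψ) α β = eval A φ α β ∨ eval A ψ α β
eval {s = s} A (exD φ) α β = any (λ v → eval A φ (v ∷ α) β) (allFin s)
eval {s = s} A (exN φ) α β = any (λ i → eval A φ α (i ∷ β)) (allFin (suc s))
eval {s = s} A (cntD φ κ) α β =
  countL (λ v → eval A φ (v ∷ α) β) (allFin s) ≡ᵇ toℕ (lookup β κ)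
eval {s = s} A (cntN φ κ) α β =
  countL (λ i → eval A φ α (i ∷ β)) (allFin (suc s)) ≡ᵇ toℕ (lookup β κ)
eval {s = s} A (lrec k ℓ m φeq φE φC xs κs) α β =
  LRecSem.X s k (suc ℓ)
    (λ v₁ v₂ → eval A φeq ((v₁ ++ v₂) ++ α) β)
    (λ v₁ v₂ → eval A φE ((v₁ ++ v₂) ++ α) β)
    (λ v is → eval A φC (v ++ α) (is ++ β))
    (V.map (lookup α) xs) (encode (V.map (lookup β) κs))

-- The counting logic C^k: variables x₁,…,x_k are Fin k (reusable).

data CF (τ : Vocab) (k : ℕ) : Set where
  rel    : (R : Fin (nsym τ)) → Vec (Fin k) (arity τ R) → CF τ k
  eq     : Fin k → Fin k → CF τ k
  neg    : CF τ k → CF τ k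
  and    : CF τ k → CF τ k → CF τ k
  or     : CF τ k → CF τ k → CF τ k
  exists≥ : ℕ → Fin k → CF τ k → CF τ k

ceval : ∀ {τ s k} → Structure τ s → CF τ k → Vec (Fin s) k → Bool
ceval A (rel R xs) β = relA A R (V.map (lookup β) xs)
ceval A (eq x y) β = ⌊ lookup β x F.≟ lookup β y ⌋
ceval A (neg ψ) β = not (ceval A ψ β)
ceval A (and ψ χ) β = ceval A ψ β ∧ ceval A χ β
ceval A (or ψ χ) β = ceval A ψ β ∨ ceval A χ β
ceval {s = s} A (exists≥ m x ψ) β =
  m ≤ᵇ countL (λ v → ceval A ψ (β [ x ]≔ v)) (allFin s)

qdepth : ∀ {τ k} → CF τ k → ℕ
qdepth (rel R xs) = 0
qdepth (eq x y) = 0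
qdepth (neg ψ) = qdepth ψ
qdepth (and ψ χ) = qdepth ψ ⊔ qdepth χ
qdepth (or ψ χ) = qdepth ψ ⊔ qdepth χ
qdepth (exists≥ m x ψ) = suc (qdepth ψ)

IsOLog : (ℕ → ℕ) → Set
IsOLog f = Σ ℕ λ c → Σ ℕ λ n₀ → ∀ n → n₀ ≤ n → f n ≤ c * ⌊log₂ n ⌋

{-# OPTIONS --safe #-}
module Submission where

-- For structures of a fixed size s, numbers and truth values are parameters, so it suffices to
-- define each relation with O(log s) nested quantifiers, reusing a bounded set of variables.
-- The equivalence closure is defined by repeated squaring, and a number of classes as
-- Σ_j #{w : P w, |[w]| = j} / j.
--
-- Membership of ([u], i) in X is the value of a computation tree.  Dividing by the in-degrees
-- makes the total size of these trees at most |V| i², hence polynomial in s.  A tree of size n is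
-- evaluated in O(log n) rounds by guessing: certificates "node a has value x" and "a has value x
-- provided that its descendant b has value y" are combined along paths so that each round doubles
-- the size that is covered.  Soundness of the certificates needs no size, so sizes occur in the
-- proof only and not in the formulas.

open import Defs
open import Data.Bool using (Bool; true; false; _∧_; _∨_; not; if_then_else_)
import Data.Bool as B
open import Data.Bool.ListAction using (any)
open import Data.Bool.Properties using (∨-comm; ∨-zeroʳ)
open import Data.Fin using (Fin; toℕ; inject≤; fromℕ<)
import Data.Fin as F
import Data.Fin.Properties as F
open import Data.List using (List; []; _∷_; length; allFin; upTo; _++_)
import Data.List as L
import Data.List.Properties as L
open import Data.List.Membership.DecPropositional using (_∈?_)
open import Data.List.Membership.Propositional using (_∈_; _∉_)
open import Data.List.Membership.Propositional.Properties using (∈-++⁺ˡ; ∈-++⁺ʳ; ∈-map⁺; ∈-concatMap⁺; ∈-allFin; ∈-upTo⁺)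
open import Data.List.Membership.Setoid.Properties using (index-injective)
open import Data.List.Relation.Unary.Any using (here; there)
import Data.List.Relation.Unary.Any as Any
open import Data.Nat using (ℕ; zero; suc; _+_; _*_; _∸_; _^_; _/_; _≤_; _<_; _≡ᵇ_; _≤ᵇ_; z≤n; s≤s; _≤?_; _<?_)
open import Data.Nat.DivMod using (m/n≤m; m/n*n≤m; m*n/n≡m; /-monoˡ-≤)
open import Data.Nat.ListAction using (sum)
open import Data.Nat.Logarithm using (⌊log₂_⌋; ⌊log₂⌋-mono-≤; ⌊log₂[2^n]⌋≡n)
open import Data.Nat.Properties
open import Data.Nat.Tactic.RingSolver using (solve-∀)
open import Data.Product using (Σ; _×_; _,_; proj₁; proj₂; ∃)
open import Data.Sum using (_⊎_; inj₁; inj₂; [_,_]′)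
open import Data.Unit using (⊤; tt)
open import Data.Vec using (Vec; []; _∷_; lookup; map; tabulate; head; _[_]≔_)
import Data.Vec as V
import Data.Vec.Properties as V
open import Function using (_∘_)
open import Relation.Binary.Definitions using (tri<; tri≈; tri>)
open import Relation.Binary.PropositionalEquality using (_≡_; _≢_; refl; sym; trans; cong; cong₂; subst; setoid; module ≡-Reasoning)
open import Relation.Nullary using (yes; no; contradiction)
open import Relation.Nullary.Decidable using (⌊_⌋; ¬?; toWitness; dec-true; decidable-stable; isYes≗does)

-- Unfolding `X` level by level would cost a block of quantifiers per level, and there can be as
-- many levels as the number `i`, which is only polynomial in s. Cutting off whole subtrees does not
-- help on a long thin tree. A certificate conditional on a descendant describes a tree with a hole,
-- and such an object can be cut again at an edge on the way to the hole; this is why two kinds of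
-- certificates are needed. Guessing the truth value at the cut is harmless: numbers strictly
-- decrease from a node to its children, so values are uniquely determined and locally consistent
-- guesses cannot support a wrong one. Two features of C shape the rest. It has no number sort, so
-- numbers become indices of formulas, and arithmetic on them is a finite disjunction without
-- quantifiers. It cannot choose representatives, so classes have to be counted through the tuples
-- in them.

∧-elim : ∀ {a b} → a ∧ b ≡ true → a ≡ true × b ≡ true
∧-elim {true} {true} _ = refl , refl

∧-intro : ∀ {a b} → a ≡ true → b ≡ true → a ∧ b ≡ true
∧-intro refl refl = refl

∨-elim : ∀ {a b} → a ∨ b ≡ true → a ≡ true ⊎ b ≡ true
∨-elim {true} _ = inj₁ refl
∨-elim {false} h = inj₂ h

∨-introˡ : ∀ {a b} → a ≡ true → a ∨ b ≡ true
∨-introˡ refl = refl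

∨-introʳ : ∀ {a b} → b ≡ true → a ∨ b ≡ true
∨-introʳ {a} refl = ∨-zeroʳ a

bool-ext : ∀ {a b} → (a ≡ true → b ≡ true) → (b ≡ true → a ≡ true) → a ≡ b
bool-ext {true} {b} f g = sym (f refl)
bool-ext {false} {true} f g = g refl
bool-ext {false} {false} f g = refl

infix 4 _==_
_==_ : Bool → Bool → Bool
true == y = y
false == y = not y

==-sound : ∀ {x y} → (x == y) ≡ true → x ≡ y
==-sound {true} h = sym h
==-sound {false} {false} h = refl

==-refl : ∀ x → (x == x) ≡ true
==-refl true = refl
==-refl false = refl

≡ᵇ-sound : ∀ m n → (m ≡ᵇ n) ≡ true → m ≡ n
≡ᵇ-sound zero zero _ = refl
≡ᵇ-sound (suc m) (suc n) h = cong suc (≡ᵇ-sound m n h)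

≡ᵇ-refl : ∀ n → (n ≡ᵇ n) ≡ true
≡ᵇ-refl zero = refl
≡ᵇ-refl (suc n) = ≡ᵇ-refl n

≡ᵇ-≢ : ∀ {m n} → m ≢ n → (m ≡ᵇ n) ≡ false
≡ᵇ-≢ {m} {n} m≢n with m ≡ᵇ n in eq
... | true = contradiction (≡ᵇ-sound m n eq) m≢n
... | false = refl

≤ᵇ-true : ∀ {m n} → m ≤ n → (m ≤ᵇ n) ≡ true
≤ᵇ-true {m} {n} m≤n with m ≤ᵇ n in eq
... | true = refl
... | false = contradiction (subst B.T eq (≤⇒≤ᵇ m≤n)) λ ()

≤ᵇ-sound : ∀ m n → (m ≤ᵇ n) ≡ true → m ≤ n
≤ᵇ-sound m n h = ≤ᵇ⇒≤ m n (subst B.T (sym h) _)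

≤ᵇ-false : ∀ {m n} → n < m → (m ≤ᵇ n) ≡ false
≤ᵇ-false {m} {n} n<m with m ≤ᵇ n in eq
... | true = contradiction (≤ᵇ-sound m n eq) (<⇒≱ n<m)
... | false = refl

-- Counts and finite sums.

⟦_⟧ : Bool → ℕ
⟦ b ⟧ = if b then 1 else 0

⟦⟧-∧ : ∀ a b → ⟦ a ∧ b ⟧ ≡ ⟦ a ⟧ * ⟦ b ⟧
⟦⟧-∧ true b = sym (*-identityˡ _)
⟦⟧-∧ false b = refl

module _ {A : Set} where

  any-intro : (p : A → Bool) → ∀ {x xs} → x ∈ xs → p x ≡ true → any p xs ≡ true
  any-intro p (here refl) h = ∨-introˡ h
  any-intro p {xs = y ∷ _} (there x∈) h = ∨-introʳ {p y} (any-intro p x∈ h)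

  any-elim : (p : A → Bool) → ∀ xs → any p xs ≡ true → ∃ λ x → x ∈ xs × p x ≡ true
  any-elim p (x ∷ xs) h with ∨-elim {p x} h
  ... | inj₁ px = x , here refl , px
  ... | inj₂ h′ with any-elim p xs h′
  ... | y , y∈ , py = y , there y∈ , py

  any-cong : {p q : A → Bool} → (∀ x → p x ≡ q x) → ∀ xs → any p xs ≡ any q xs
  any-cong p≗q [] = refl
  any-cong p≗q (x ∷ xs) = cong₂ _∨_ (p≗q x) (any-cong p≗q xs)

  ∑ : (A → ℕ) → List A → ℕ
  ∑ f xs = sum (L.map f xs)

  ∑-cong : {f g : A → ℕ} → (∀ x → f x ≡ g x) → ∀ xs → ∑ f xs ≡ ∑ g xs
  ∑-cong f≗g [] = refl
  ∑-cong f≗g (x ∷ xs) = cong₂ _+_ (f≗g x) (∑-cong f≗g xs)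

  ∑-mono : {f g : A → ℕ} → (∀ x → f x ≤ g x) → ∀ xs → ∑ f xs ≤ ∑ g xs
  ∑-mono f≤g [] = z≤n
  ∑-mono f≤g (x ∷ xs) = +-mono-≤ (f≤g x) (∑-mono f≤g xs)

  ∑-zero : ∀ xs → ∑ (λ _ → 0) xs ≡ 0
  ∑-zero [] = refl
  ∑-zero (x ∷ xs) = ∑-zero xs

  ∑-const : ∀ c xs → ∑ (λ _ → c) xs ≡ length xs * c
  ∑-const c [] = refl
  ∑-const c (x ∷ xs) = cong (c +_) (∑-const c xs)

  ∑-+ : ∀ (f g : A → ℕ) xs → ∑ (λ x → f x + g x) xs ≡ ∑ f xs + ∑ g xs
  ∑-+ f g [] = refl
  ∑-+ f g (x ∷ xs) = trans (cong (f x + g x +_) (∑-+ f g xs)) (interchange (f x) (g x) (∑ f xs) (∑ g xs))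
    where
    interchange : ∀ a b c d → a + b + (c + d) ≡ a + c + (b + d)
    interchange = solve-∀

  ∑-*ʳ : ∀ (f : A → ℕ) c xs → ∑ (λ x → f x * c) xs ≡ ∑ f xs * c
  ∑-*ʳ f c [] = refl
  ∑-*ʳ f c (x ∷ xs) = trans (cong (f x * c +_) (∑-*ʳ f c xs)) (sym (*-distribʳ-+ c (f x) (∑ f xs)))

  countL-∑ : ∀ (p : A → Bool) xs → countL p xs ≡ ∑ (⟦_⟧ ∘ p) xs
  countL-∑ p [] = refl
  countL-∑ p (x ∷ xs) = cong (⟦ p x ⟧ +_) (countL-∑ p xs)

  countL-cong : {p q : A → Bool} → (∀ x → p x ≡ q x) → ∀ xs → countL p xs ≡ countL q xs
  countL-cong p≗q [] = refl
  countL-cong p≗q (x ∷ xs) = cong₂ (λ b n → ⟦ b ⟧ + n) (p≗q x) (countL-cong p≗q xs)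

  countL≤length : ∀ (p : A → Bool) xs → countL p xs ≤ length xs
  countL≤length p [] = z≤n
  countL≤length p (x ∷ xs) with p x
  ... | true = s≤s (countL≤length p xs)
  ... | false = m≤n⇒m≤1+n (countL≤length p xs)

  countL-mono : {p q : A → Bool} → (∀ x → p x ≡ true → q x ≡ true) → ∀ xs → countL p xs ≤ countL q xs
  countL-mono p⇒q [] = z≤n
  countL-mono {p} {q} p⇒q (x ∷ xs) with p x in px | q x in qx
  ... | true | true = s≤s (countL-mono p⇒q xs)
  ... | true | false = contradiction (trans (sym qx) (p⇒q x px)) λ ()
  ... | false | true = m≤n⇒m≤1+n (countL-mono p⇒q xs)
  ... | false | false = countL-mono p⇒q xs

  countL-pos : (p : A → Bool) → ∀ {x xs} → x ∈ xs → p x ≡ true → 0 < countL p xs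
  countL-pos p (here refl) h rewrite h = s≤s z≤n
  countL-pos p {xs = y ∷ _} (there x∈) h = ≤-trans (countL-pos p x∈ h) (m≤n+m _ ⟦ p y ⟧)

  -- Turns "the count did not grow" into "the set did not grow", which is how the search for
  -- equivalent tuples is seen to have stabilised.
  countL-tight : {p q : A → Bool} → (∀ x → p x ≡ true → q x ≡ true) → ∀ {x xs} →
    countL q xs ≤ countL p xs → x ∈ xs → q x ≡ true → p x ≡ true
  countL-tight {p} {q} p⇒q {x} {y ∷ ys} h x∈ qx with p y in py | q y in qy | x∈
  ... | true | true | here refl = py
  ... | true | true | there x∈′ = countL-tight p⇒q (≤-pred h) x∈′ qx
  ... | true | false | _ = contradiction (trans (sym qy) (p⇒q y py)) λ ()
  ... | false | true | _ = contradiction h (<⇒≱ (s≤s (countL-mono p⇒q ys)))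
  ... | false | false | here refl = contradiction (trans (sym qy) qx) λ ()
  ... | false | false | there x∈′ = countL-tight p⇒q h x∈′ qx

  ∑-++ : ∀ (f : A → ℕ) xs ys → ∑ f (xs ++ ys) ≡ ∑ f xs + ∑ f ys
  ∑-++ f [] ys = refl
  ∑-++ f (x ∷ xs) ys = trans (cong (f x +_) (∑-++ f xs ys)) (sym (+-assoc (f x) _ _))

∑-swap : ∀ {A B : Set} (f : A → B → ℕ) xs ys →
  ∑ (λ x → ∑ (f x) ys) xs ≡ ∑ (λ y → ∑ (λ x → f x y) xs) ys
∑-swap f [] ys = sym (∑-zero ys)
∑-swap f (x ∷ xs) ys = trans (cong (∑ (f x) ys +_) (∑-swap f xs ys)) (sym (∑-+ (f x) _ ys))

∑-map : ∀ {A B : Set} (f : B → ℕ) (g : A → B) xs → ∑ f (L.map g xs) ≡ ∑ (f ∘ g) xs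
∑-map f g xs = cong sum (sym (L.map-∘ xs))

∑-concatMap : ∀ {A B : Set} (f : B → ℕ) (g : A → List B) xs →
  ∑ f (L.concatMap g xs) ≡ ∑ (λ x → ∑ f (g x)) xs
∑-concatMap f g [] = refl
∑-concatMap f g (x ∷ xs) = trans (∑-++ f (g x) _) (cong (∑ f (g x) +_) (∑-concatMap f g xs))

∑< : ℕ → (ℕ → ℕ) → ℕ
∑< zero f = 0
∑< (suc n) f = ∑< n f + f n

∑<-cong : ∀ n {f g : ℕ → ℕ} → (∀ i → f i ≡ g i) → ∑< n f ≡ ∑< n g
∑<-cong zero f≗g = refl
∑<-cong (suc n) f≗g = cong₂ _+_ (∑<-cong n f≗g) (f≗g n)

∑<-*ˡ : ∀ n c (f : ℕ → ℕ) → ∑< n (λ i → c * f i) ≡ c * ∑< n f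
∑<-*ˡ zero c f = sym (*-zeroʳ c)
∑<-*ˡ (suc n) c f = trans (cong (_+ c * f n) (∑<-*ˡ n c f)) (sym (*-distribˡ-+ c _ (f n)))

∑<-∑-swap : ∀ {A : Set} n (f : ℕ → A → ℕ) xs →
  ∑< n (λ i → ∑ (f i) xs) ≡ ∑ (λ x → ∑< n (λ i → f i x)) xs
∑<-∑-swap zero f xs = sym (∑-zero xs)
∑<-∑-swap (suc n) f xs = trans (cong (_+ ∑ (f n) xs) (∑<-∑-swap n f xs)) (sym (∑-+ _ (f n) xs))

∑<-≡ᵇ-out : ∀ n {m} → n ≤ m → ∑< n (λ i → ⟦ m ≡ᵇ i ⟧) ≡ 0
∑<-≡ᵇ-out zero _ = refl
∑<-≡ᵇ-out (suc n) {m} n<m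
  rewrite ∑<-≡ᵇ-out n {m} (<⇒≤ n<m) | ≡ᵇ-≢ {m} {n} (>⇒≢ n<m) = refl

∑<-≡ᵇ : ∀ n {m} → m < n → ∑< n (λ i → ⟦ m ≡ᵇ i ⟧) ≡ 1
∑<-≡ᵇ (suc n) {m} m<1+n with m≤n⇒m<n∨m≡n (≤-pred m<1+n)
... | inj₁ m<n rewrite ∑<-≡ᵇ n m<n | ≡ᵇ-≢ {m} {n} (<⇒≢ m<n) = refl
... | inj₂ refl rewrite ∑<-≡ᵇ-out n {m} ≤-refl | ≡ᵇ-refl m = refl

-- A bounded number as a sum of its unit layers; summing over elements, this reduces a sum of
-- numbers to counts of the elements above each threshold.
∑<-<ᵇ : ∀ n {m} → m ≤ n → ∑< n (λ i → ⟦ suc i ≤ᵇ m ⟧) ≡ m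
∑<-<ᵇ zero z≤n = refl
∑<-<ᵇ (suc n) {m} m≤1+n with m≤n⇒m<n∨m≡n m≤1+n
... | inj₁ m<1+n rewrite ∑<-<ᵇ n (≤-pred m<1+n) | ≤ᵇ-false {suc n} m<1+n = +-identityʳ m
... | inj₂ refl rewrite ≤ᵇ-true {suc n} ≤-refl = trans (cong (_+ 1) (below n (n≤1+n n))) (+-comm n 1)
  where
  below : ∀ m {k} → m ≤ k → ∑< m (λ i → ⟦ suc i ≤ᵇ k ⟧) ≡ m
  below zero _ = refl
  below (suc m) {k} m<k rewrite below m {k} (<⇒≤ m<k) | ≤ᵇ-true m<k = +-comm m 1

-- Enumeration of tuples, the size of encoded numbers, floor division.

∈-tuples : ∀ {s k} (v : Vec (Fin s) k) → v ∈ tuples s k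
∈-tuples [] = here refl
∈-tuples {s} {suc k} (x ∷ v) =
  ∈-concatMap⁺ (λ y → L.map (y ∷_) (tuples s k)) (Any.map (λ { refl → ∈-map⁺ (x ∷_) (∈-tuples v) }) (∈-allFin x))

length-tuples : ∀ s k → length (tuples s k) ≡ s ^ k
length-tuples s zero = refl
length-tuples s (suc k) = begin
  length (tuples s (suc k))
    ≡⟨ length-∑ (tuples s (suc k)) ⟩
  ∑ (λ _ → 1) (tuples s (suc k))
    ≡⟨ ∑-concatMap (λ _ → 1) (λ v → L.map (v ∷_) (tuples s k)) (allFin s) ⟩
  ∑ (λ v → ∑ (λ _ → 1) (L.map (v ∷_) (tuples s k))) (allFin s)
    ≡⟨ ∑-cong (λ v → trans (∑-map (λ _ → 1) (v ∷_) (tuples s k))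
         (trans (sym (length-∑ (tuples s k))) (length-tuples s k))) (allFin s) ⟩
  ∑ (λ _ → s ^ k) (allFin s)
    ≡⟨ ∑-const (s ^ k) (allFin s) ⟩
  length (allFin s) * s ^ k
    ≡⟨ cong (_* s ^ k) (L.length-tabulate {n = s} (λ i → i)) ⟩
  s * s ^ k ∎
  where
  open ≡-Reasoning
  length-∑ : ∀ {A : Set} (xs : List A) → length xs ≡ ∑ (λ _ → 1) xs
  length-∑ xs = trans (sym (*-identityʳ _)) (sym (∑-const 1 xs))

encode< : ∀ {s ℓ} (is : Vec (Fin (suc s)) ℓ) → encode is < suc s ^ ℓ
encode< [] = s≤s z≤n
encode< {s} {suc ℓ} (i ∷ is) = begin-strict
  toℕ i + suc s * encode is   <⟨ +-monoˡ-< (suc s * encode is) (F.toℕ<n i) ⟩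
  suc s + suc s * encode is   ≡⟨ *-suc (suc s) (encode is) ⟨
  suc s * suc (encode is)     ≤⟨ *-monoʳ-≤ (suc s) (encode< is) ⟩
  suc s * suc s ^ ℓ           ∎
  where
  open ≤-Reasoning

divOr0-≤ : ∀ j d → divOr0 j d ≤ j
divOr0-≤ j zero = z≤n
divOr0-≤ j (suc d) = m/n≤m j (suc d)

-- A vertex of in-degree d receives the share `divOr0 j d` along each of its d incoming edges; all
-- shares together stay within j.
*-divOr0-≤ : ∀ d j → d * divOr0 j d ≤ j
*-divOr0-≤ zero j = z≤n
*-divOr0-≤ (suc d) j = ≤-trans (≤-reflexive (*-comm (suc d) _)) (m/n*n≤m j (suc d))

divOr0-+ : ∀ d a b → divOr0 a d + divOr0 b d ≤ divOr0 (a + b) d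
divOr0-+ zero a b = z≤n
divOr0-+ (suc d) a b = +-/-≤
  where
  +-/-≤ : a / suc d + b / suc d ≤ (a + b) / suc d
  +-/-≤ = begin
    a / suc d + b / suc d
      ≡⟨ m*n/n≡m (a / suc d + b / suc d) (suc d) ⟨
    (a / suc d + b / suc d) * suc d / suc d
      ≡⟨ cong (_/ suc d) (*-distribʳ-+ (suc d) (a / suc d) (b / suc d)) ⟩
    (a / suc d * suc d + b / suc d * suc d) / suc d
      ≤⟨ /-monoˡ-≤ (suc d) (+-mono-≤ (m/n*n≤m a (suc d)) (m/n*n≤m b (suc d))) ⟩
    (a + b) / suc d ∎
    where open ≤-Reasoning

vecEq-refl : ∀ {s k} (u : Vec (Fin s) k) → vecEq u u ≡ true
vecEq-refl u = trans (isYes≗does (V.≡-dec F._≟_ u u)) (dec-true (V.≡-dec F._≟_ u u) refl)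

vecEq-sound : ∀ {s k} (u v : Vec (Fin s) k) → vecEq u v ≡ true → u ≡ v
vecEq-sound u v h = toWitness {a? = V.≡-dec F._≟_ u v} (subst B.T (sym h) _)

-- The equivalence relation and the quotient graph.

module Quotient (s k ℓ : ℕ)
  (eq E : Vec (Fin s) k → Vec (Fin s) k → Bool)
  (C : Vec (Fin s) k → Vec (Fin (suc s)) ℓ → Bool) where

  open LRecSem s k ℓ eq E C

  Tup : Set
  Tup = Vec (Fin s) k

  reach-refl : ∀ f u → reach f u u ≡ true
  reach-refl zero u = vecEq-refl u
  reach-refl (suc f) u = ∨-introˡ (vecEq-refl u)

  reach-step : ∀ f {u w v} → eq u w ∨ eq w u ≡ true → reach f w v ≡ true → reach (suc f) u v ≡ true
  reach-step f {u} {w} {v} a h = ∨-introʳ {vecEq u v}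
    (any-intro (λ w → (eq u w ∨ eq w u) ∧ reach f w v) (∈-tuples w) (∧-intro a h))

  reach-elim : ∀ f {u v} → reach (suc f) u v ≡ true →
    u ≡ v ⊎ (∃ λ w → (eq u w ∨ eq w u ≡ true) × reach f w v ≡ true)
  reach-elim f {u} {v} h with ∨-elim {vecEq u v} h
  ... | inj₁ u=v = inj₁ (vecEq-sound u v u=v)
  ... | inj₂ h′ with any-elim _ T h′
  ... | w , _ , aw = inj₂ (w , ∧-elim aw)

  reach-suc : ∀ f {u v} → reach f u v ≡ true → reach (suc f) u v ≡ true
  reach-suc zero {u} {v} h rewrite h = refl
  reach-suc (suc f) {u} {v} h with reach-elim f h
  ... | inj₁ refl = reach-refl (suc (suc f)) u
  ... | inj₂ (w , a , h′) = reach-step (suc f) a (reach-suc f h′)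

  reach-+ : ∀ g f {u v} → reach f u v ≡ true → reach (g + f) u v ≡ true
  reach-+ zero f h = h
  reach-+ (suc g) f h = reach-suc (g + f) (reach-+ g f h)

  Stable : ℕ → Tup → Set
  Stable f v = ∀ u → reach (suc f) u v ≡ true → reach f u v ≡ true

  stable-suc : ∀ f {v} → Stable f v → Stable (suc f) v
  stable-suc f st u h with reach-elim (suc f) h
  ... | inj₁ refl = reach-refl (suc f) u
  ... | inj₂ (w , a , h′) = reach-step f a (st w h′)

  -- As long as it is not stable, the set of tuples reaching v gains an element at each step.
  stable-or-large : ∀ f v → Stable f v ⊎ f < countL (λ u → reach f u v) T
  stable-or-large zero v = inj₂ (countL-pos (λ u → reach 0 u v) (∈-tuples v) (vecEq-refl v))
  stable-or-large (suc f) v with stable-or-large f v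
  ... | inj₁ st = inj₁ (stable-suc f st)
  ... | inj₂ large with countL (λ u → reach (suc f) u v) T ≤? countL (λ u → reach f u v) T
  ... | yes tight = inj₁ (stable-suc f λ u → countL-tight (λ _ → reach-suc f) tight (∈-tuples u))
  ... | no loose = inj₂ (≤-trans (s≤s large) (≰⇒> loose))

  stable-T : ∀ v → Stable (length T) v
  stable-T v with stable-or-large (length T) v
  ... | inj₁ st = st
  ... | inj₂ large = contradiction (countL≤length (λ u → reach (length T) u v) T) (<⇒≱ large)

  reach-stable : ∀ g f {v} → Stable f v → ∀ {u} → reach (g + f) u v ≡ true → reach f u v ≡ true
  reach-stable zero f st h = h
  reach-stable (suc g) f st {u} h = reach-stable g f st (stable-+ g u h)
    where
    stable-+ : ∀ g → Stable (g + f) _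
    stable-+ zero = st
    stable-+ (suc g) = stable-suc (g + f) (stable-+ g)

  -- Fuel beyond `length T` finds nothing new, since the set of tuples reaching `v` is stable by
  -- then. Transitivity of `sim` depends on this, because concatenating two searches adds their
  -- fuels.
  reach⇒sim : ∀ f {u v} → reach f u v ≡ true → sim u v ≡ true
  reach⇒sim f {u} {v} h =
    reach-stable f (length T) (stable-T v)
      (subst (λ n → reach n u v ≡ true) (+-comm (length T) f) (reach-+ (length T) f h))

  reach-trans : ∀ f g {u v w} → reach f u v ≡ true → reach g v w ≡ true → reach (f + g) u w ≡ true
  reach-trans zero g {u} {v} h h′ with vecEq-sound u v h
  ... | refl = h′
  reach-trans (suc f) g {u} h h′ with reach-elim f h
  ... | inj₁ refl = reach-+ (suc f) g h′
  ... | inj₂ (w , a , h″) = reach-step (f + g) a (reach-trans f g h″ h′)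

  reach-sym : ∀ f {u v} → reach f u v ≡ true → reach f v u ≡ true
  reach-sym zero {u} {v} h with vecEq-sound u v h
  ... | refl = h
  reach-sym (suc f) {u} {v} h with reach-elim f h
  ... | inj₁ refl = h
  ... | inj₂ (w , a , h′) = subst (λ n → reach n v u ≡ true) (+-comm f 1)
    (reach-trans f 1 (reach-sym f h′) (reach-step 0 (trans (∨-comm (eq w u) (eq u w)) a) (vecEq-refl u)))

  sim-refl : ∀ u → sim u u ≡ true
  sim-refl = reach-refl (length T)

  sim-sym : ∀ {u v} → sim u v ≡ true → sim v u ≡ true
  sim-sym = reach-sym (length T)

  sim-trans : ∀ {u v w} → sim u v ≡ true → sim v w ≡ true → sim u w ≡ true
  sim-trans h h′ = reach⇒sim (length T + length T) (reach-trans (length T) (length T) h h′)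

  sim-comm : ∀ u v → sim u v ≡ sim v u
  sim-comm u v = bool-ext sim-sym sim-sym

  sim-congˡ : ∀ {u u′} → sim u u′ ≡ true → ∀ v → sim u v ≡ sim u′ v
  sim-congˡ h v = bool-ext (sim-trans (sim-sym h)) (sim-trans h)

  -- Paths of at most `2 ^ t` steps, cut at a midpoint. Equality in the base case lets shorter paths
  -- be padded.
  double : ℕ → Tup → Tup → Bool
  double zero u v = vecEq u v ∨ (eq u v ∨ eq v u)
  double (suc t) u v = any (λ w → double t u w ∧ double t w v) T

  double-refl : ∀ t u → double t u u ≡ true
  double-refl zero u = ∨-introˡ (vecEq-refl u)
  double-refl (suc t) u = any-intro _ (∈-tuples u) (∧-intro (double-refl t u) (double-refl t u))

  reach-split : ∀ f g {u v} → reach (f + g) u v ≡ true → ∃ λ w → reach f u w ≡ true × reach g w v ≡ true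
  reach-split zero g {u} h = u , vecEq-refl u , h
  reach-split (suc f) g {u} h with reach-elim (f + g) h
  ... | inj₁ refl = u , reach-refl (suc f) u , reach-refl g u
  ... | inj₂ (w , a , h′) with reach-split f g h′
  ... | x , h₁ , h₂ = x , reach-step f a h₁ , h₂

  reach⇒double : ∀ t {u v} → reach (2 ^ t) u v ≡ true → double t u v ≡ true
  reach⇒double zero {u} {v} h with reach-elim 0 h
  ... | inj₁ refl = double-refl 0 u
  ... | inj₂ (w , a , h′) with vecEq-sound w v h′
  ... | refl = ∨-introʳ {vecEq u v} a
  reach⇒double (suc t) {u} {v} h
    with reach-split (2 ^ t) (2 ^ t) (subst (λ n → reach (2 ^ t + n) u v ≡ true) (+-identityʳ (2 ^ t)) h)
  ... | w , h₁ , h₂ = any-intro _ (∈-tuples w) (∧-intro (reach⇒double t h₁) (reach⇒double t h₂))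

  double⇒sim : ∀ t {u v} → double t u v ≡ true → sim u v ≡ true
  double⇒sim zero {u} {v} h with ∨-elim {vecEq u v} h
  ... | inj₁ u=v = subst (λ v → sim u v ≡ true) (vecEq-sound u v u=v) (sim-refl u)
  ... | inj₂ a = reach⇒sim 1 (reach-step 0 a (vecEq-refl v))
  double⇒sim (suc t) h with any-elim _ T h
  ... | w , _ , hw with ∧-elim hw
  ... | h₁ , h₂ = sim-trans (double⇒sim t h₁) (double⇒sim t h₂)

  -- Only one direction needs `t` to be large: `double t` never leaves `sim`, whatever `t` is.
  double≡sim : ∀ t → length T ≤ 2 ^ t → ∀ u v → double t u v ≡ sim u v
  double≡sim t T≤ u v = bool-ext (double⇒sim t) λ h → reach⇒double t
    (subst (λ n → reach n u v ≡ true) (m∸n+n≡m T≤) (reach-+ (2 ^ t ∸ length T) (length T) h))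

  edgeG-congˡ : ∀ {u u′} → sim u u′ ≡ true → ∀ v → edgeG u v ≡ edgeG u′ v
  edgeG-congˡ h v = any-cong (λ x → cong (_∧ _) (sim-congˡ h x)) T

  edgeG-congʳ : ∀ {v v′} → sim v v′ ≡ true → ∀ u → edgeG u v ≡ edgeG u v′
  edgeG-congʳ h u = any-cong (λ x → cong (sim u x ∧_) (any-cong (λ y → cong (_∧ E x y) (sim-congˡ h y)) T)) T

  inC-cong : ∀ {u u′} → sim u u′ ≡ true → ∀ j → inC u j ≡ inC u′ j
  inC-cong h j = any-cong (λ is → cong ((encode is ≡ᵇ j) ∧_)
    (any-cong (λ x → cong (_∧ C x is) (sim-congˡ h x)) T)) (tuples (suc s) ℓ)

  -- Counting equivalence classes.

  -- The last member of each class in the list, as in `countClasses`. The choice depends on the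
  -- enumeration, so it serves the proofs only and is never expressed by a formula.
  reps : List Tup → List Tup
  reps [] = []
  reps (w ∷ ws) = if any (sim w) ws then reps ws else w ∷ reps ws

  -- The local function of countClasses can only be named through unification.
  mutual
    countClasses-reps : ∀ P → countClasses P ≡ countL P (reps T)
    countClasses-reps P with tuples s k
    ... | ws = go-reps P ws

    go-reps : ∀ P ws → _ ≡ countL P (reps ws)
    go-reps P [] = refl
    go-reps P (w ∷ ws) with any (sim w) ws
    go-reps P (w ∷ ws) | true with P w
    ... | true = go-reps P ws
    ... | false = go-reps P ws
    go-reps P (w ∷ ws) | false with P w
    ... | true = cong suc (go-reps P ws)
    ... | false = go-reps P ws

  length-reps : ∀ ws → length (reps ws) ≤ length ws
  length-reps [] = z≤n
  length-reps (w ∷ ws) with any (sim w) ws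
  ... | true = m≤n⇒m≤1+n (length-reps ws)
  ... | false = s≤s (length-reps ws)

  -- For `w` equivalent to the head `r`, there are two cases: `r` is dropped because its class
  -- recurs in the tail, and then the tail already contributes 1; or `r` is kept because its class
  -- does not recur, and then the tail contributes 0.
  countL-reps : ∀ w ws → countL (sim w) (reps ws) ≡ ⟦ any (sim w) ws ⟧
  countL-reps w [] = refl
  countL-reps w (r ∷ rs) with any (sim r) rs in seen | sim w r in w~r
  ... | true | true rewrite countL-reps w rs | any-cong (sim-congˡ w~r) rs | seen = refl
  ... | true | false = countL-reps w rs
  ... | false | true rewrite w~r | countL-reps w rs | any-cong (sim-congˡ w~r) rs | seen = refl
  ... | false | false rewrite w~r = countL-reps w rs

  countL-reps-T : ∀ w → countL (sim w) (reps T) ≡ 1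
  countL-reps-T w = trans (countL-reps w T) (cong ⟦_⟧ (any-intro (sim w) (∈-tuples w) (sim-refl w)))

  countClasses-cong : ∀ {P Q} → (∀ w → P w ≡ Q w) → countClasses P ≡ countClasses Q
  countClasses-cong {P} {Q} P≗Q =
    trans (countClasses-reps P) (trans (countL-cong P≗Q (reps T)) (sym (countClasses-reps Q)))

  Invariant : (Tup → Bool) → Set
  Invariant P = ∀ {u v} → sim u v ≡ true → P u ≡ P v

  classSize : Tup → ℕ
  classSize w = countL (sim w) T

  classSize-cong : ∀ {u v} → sim u v ≡ true → classSize u ≡ classSize v
  classSize-cong h = countL-cong (sim-congˡ h) T

  classSize-pos : ∀ w → 0 < classSize w
  classSize-pos w = countL-pos (sim w) (∈-tuples w) (sim-refl w)

  ofSize : (Tup → Bool) → ℕ → Tup → Bool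
  ofSize P j w = P w ∧ (classSize w ≡ᵇ j)

  -- A count of classes that does not choose representatives.
  countBySize : (Tup → Bool) → ℕ
  countBySize P = ∑< (length T) λ j → countL (ofSize P (suc j)) T / suc j

  countBySize-cong : ∀ {P Q} → (∀ w → P w ≡ Q w) → countBySize P ≡ countBySize Q
  countBySize-cong P≗Q = ∑<-cong (length T) λ j →
    cong (_/ suc j) (countL-cong (λ w → cong (_∧ (classSize w ≡ᵇ suc j)) (P≗Q w)) T)

  -- Double counting of the pairs of a tuple and a representative equivalent to it: each tuple has
  -- exactly one, and each representative `r` has `classSize r` partners.
  countL-invariant : ∀ Q → Invariant Q → countL Q T ≡ ∑ (λ r → ⟦ Q r ⟧ * classSize r) (reps T)
  countL-invariant Q inv = begin
    countL Q T
      ≡⟨ countL-∑ Q T ⟩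
    ∑ (λ w → ⟦ Q w ⟧) T
      ≡⟨ ∑-cong (λ w → sym (trans
           (cong (_* ⟦ Q w ⟧) (trans (sym (countL-∑ (sim w) (reps T))) (countL-reps-T w)))
           (*-identityˡ _))) T ⟩
    ∑ (λ w → ∑ (λ r → ⟦ sim w r ⟧) (reps T) * ⟦ Q w ⟧) T
      ≡⟨ ∑-cong (λ w → sym (∑-*ʳ (λ r → ⟦ sim w r ⟧) ⟦ Q w ⟧ (reps T))) T ⟩
    ∑ (λ w → ∑ (λ r → ⟦ sim w r ⟧ * ⟦ Q w ⟧) (reps T)) T
      ≡⟨ ∑-swap (λ w r → ⟦ sim w r ⟧ * ⟦ Q w ⟧) T (reps T) ⟩
    ∑ (λ r → ∑ (λ w → ⟦ sim w r ⟧ * ⟦ Q w ⟧) T) (reps T)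
      ≡⟨ ∑-cong (λ r → ∑-cong (λ w → transfer w r) T) (reps T) ⟩
    ∑ (λ r → ∑ (λ w → ⟦ sim r w ⟧ * ⟦ Q r ⟧) T) (reps T)
      ≡⟨ ∑-cong (λ r → trans (∑-*ʳ (λ w → ⟦ sim r w ⟧) ⟦ Q r ⟧ T)
           (trans (cong (_* ⟦ Q r ⟧) (sym (countL-∑ (sim r) T))) (*-comm _ ⟦ Q r ⟧))) (reps T) ⟩
    ∑ (λ r → ⟦ Q r ⟧ * classSize r) (reps T) ∎
    where
    open ≡-Reasoning
    transfer : ∀ w r → ⟦ sim w r ⟧ * ⟦ Q w ⟧ ≡ ⟦ sim r w ⟧ * ⟦ Q r ⟧
    transfer w r with sim w r in w~r
    ... | true rewrite sim-sym w~r | inv w~r = refl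
    ... | false rewrite trans (sim-comm r w) w~r = refl

  -- Classes of equal size contribute equally many tuples, so the floor division in `countBySize` is
  -- exact.
  countL-ofSize : ∀ P → Invariant P → ∀ j →
    countL (ofSize P (suc j)) T ≡ countL (ofSize P (suc j)) (reps T) * suc j
  countL-ofSize P inv j = begin
    countL Q T                                     ≡⟨ countL-invariant Q inv′ ⟩
    ∑ (λ r → ⟦ Q r ⟧ * classSize r) (reps T)       ≡⟨ ∑-cong size (reps T) ⟩
    ∑ (λ r → ⟦ Q r ⟧ * suc j) (reps T)             ≡⟨ ∑-*ʳ (λ r → ⟦ Q r ⟧) (suc j) (reps T) ⟩
    ∑ (λ r → ⟦ Q r ⟧) (reps T) * suc j             ≡⟨ cong (_* suc j) (sym (countL-∑ Q (reps T))) ⟩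
    countL Q (reps T) * suc j                      ∎
    where
    open ≡-Reasoning
    Q : Tup → Bool
    Q = ofSize P (suc j)
    inv′ : Invariant Q
    inv′ h = cong₂ (λ b n → b ∧ (n ≡ᵇ suc j)) (inv h) (classSize-cong h)
    size : ∀ r → ⟦ Q r ⟧ * classSize r ≡ ⟦ Q r ⟧ * suc j
    size r with Q r in Qr
    ... | true = cong (1 *_) (≡ᵇ-sound (classSize r) (suc j) (proj₂ (∧-elim {P r} Qr)))
    ... | false = refl

  countBySize≡countClasses : ∀ P → Invariant P → countBySize P ≡ countClasses P
  countBySize≡countClasses P inv = begin
    countBySize P
      ≡⟨ ∑<-cong (length T) (λ j → trans (cong (_/ suc j) (countL-ofSize P inv j)) (m*n/n≡m _ (suc j))) ⟩
    ∑< (length T) (λ j → countL (ofSize P (suc j)) (reps T))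
      ≡⟨ ∑<-cong (length T) (λ j → trans (countL-∑ (ofSize P (suc j)) (reps T)) (∑-cong (λ r → ⟦⟧-∧ (P r) _) (reps T))) ⟩
    ∑< (length T) (λ j → ∑ (λ r → ⟦ P r ⟧ * ⟦ classSize r ≡ᵇ suc j ⟧) (reps T))
      ≡⟨ ∑<-∑-swap (length T) (λ j r → ⟦ P r ⟧ * ⟦ classSize r ≡ᵇ suc j ⟧) (reps T) ⟩
    ∑ (λ r → ∑< (length T) (λ j → ⟦ P r ⟧ * ⟦ classSize r ≡ᵇ suc j ⟧)) (reps T)
      ≡⟨ ∑-cong (λ r → trans (∑<-*ˡ (length T) ⟦ P r ⟧ _) (trans (cong (⟦ P r ⟧ *_) (oneSize r)) (*-identityʳ _))) (reps T) ⟩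
    ∑ (λ r → ⟦ P r ⟧) (reps T)
      ≡⟨ countL-∑ P (reps T) ⟨
    countL P (reps T)
      ≡⟨ countClasses-reps P ⟨
    countClasses P ∎
    where
    open ≡-Reasoning
    -- A class size lies between 1 and `length T`, which are exactly the values of `suc j`; so each
    -- class is counted for one `j` only.
    oneSize : ∀ r → ∑< (length T) (λ j → ⟦ classSize r ≡ᵇ suc j ⟧) ≡ 1
    oneSize r with classSize r | classSize-pos r | countL≤length (sim r) T
    ... | suc c | _ | c< = ∑<-≡ᵇ (length T) c<

  -- The recursion without fuel and the size of its computation trees.

  next : ℕ → Tup → ℕ
  next j w = divOr0 j (indeg w)

  indeg-cong : ∀ {w w′} → sim w w′ ≡ true → indeg w ≡ indeg w′
  indeg-cong h = countClasses-cong (edgeG-congʳ h)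

  next-cong : ∀ j {w w′} → sim w w′ ≡ true → next j w ≡ next j w′
  next-cong j h = cong (divOr0 j) (indeg-cong h)

  next-≤ : ∀ j w → next j w ≤ j
  next-≤ j w = divOr0-≤ j (indeg w)

  Xf-zero : ∀ f u → Xf f u 0 ≡ false
  Xf-zero zero u = refl
  Xf-zero (suc f) u = refl

  -- By `next-≤` every call lowers the number by at least one, so fuel above the number is idle.
  Xf-fuel : ∀ f f′ u i → i ≤ f → i ≤ f′ → Xf f u i ≡ Xf f′ u i
  Xf-fuel f f′ u zero _ _ = trans (Xf-zero f u) (sym (Xf-zero f′ u))
  Xf-fuel (suc f) (suc f′) u (suc j) (s≤s j≤f) (s≤s j≤f′) =
    cong (inC u) (countClasses-cong λ w → cong (edgeG u w ∧_)
      (Xf-fuel f f′ w (next j w) (≤-trans (next-≤ j w) j≤f) (≤-trans (next-≤ j w) j≤f′)))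

  X-suc : ∀ u j → X u (suc j) ≡ inC u (countClasses λ w → edgeG u w ∧ X w (next j w))
  X-suc u j = cong (inC u) (countClasses-cong λ w → cong (edgeG u w ∧_)
    (Xf-fuel j (next j w) w (next j w) (next-≤ j w) ≤-refl))

  X-cong : ∀ i {u u′} → sim u u′ ≡ true → X u i ≡ X u′ i
  X-cong zero h = refl
  X-cong (suc j) {u} {u′} h = trans (inC-cong h _)
    (cong (inC u′) (countClasses-cong λ w → cong (_∧ _) (edgeG-congˡ h w)))

  X-next-cong : ∀ j {e e′} → sim e e′ ≡ true → X e (next j e) ≡ X e′ (next j e′)
  X-next-cong j {e} {e′} h = trans (cong (X e) (next-cong j h)) (X-cong (next j e′) h)

  -- An upper bound on the size of the unfolded computation tree below ([u], i).  The summand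
  -- suc j (instead of 1) makes it superadditive in i.
  weight : ℕ → ℕ → Tup → ℕ
  weight zero i u = 0
  weight (suc f) zero u = 0
  weight (suc f) (suc j) u = suc j + ∑ (λ r → ⟦ edgeG u r ⟧ * weight f (next j r) r) (reps T)

  weight-zero : ∀ f u → weight f 0 u ≡ 0
  weight-zero zero u = refl
  weight-zero (suc f) u = refl

  weight-fuel : ∀ f f′ i u → i ≤ f → i ≤ f′ → weight f i u ≡ weight f′ i u
  weight-fuel f f′ zero u _ _ = trans (weight-zero f u) (sym (weight-zero f′ u))
  weight-fuel (suc f) (suc f′) (suc j) u (s≤s j≤f) (s≤s j≤f′) =
    cong (suc j +_) (∑-cong (λ w → cong (⟦ edgeG u w ⟧ *_)
      (weight-fuel f f′ (next j w) w (≤-trans (next-≤ j w) j≤f) (≤-trans (next-≤ j w) j≤f′))) (reps T))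

  weight-cong : ∀ f i {u u′} → sim u u′ ≡ true → weight f i u ≡ weight f i u′
  weight-cong zero i h = refl
  weight-cong (suc f) zero h = refl
  weight-cong (suc f) (suc j) h = cong (suc j +_)
    (∑-cong (λ r → cong (λ b → ⟦ b ⟧ * weight f (next j r) r) (edgeG-congˡ h r)) (reps T))

  -- Floor division is superadditive by `divOr0-+`, and this passes through the recursion. It is
  -- what allows the shares arriving at one vertex to be merged into a single larger number.
  weight-superadditive : ∀ f a b u → weight f a u + weight f b u ≤ weight f (a + b) u
  weight-superadditive zero a b u = z≤n
  weight-superadditive (suc f) zero b u = ≤-refl
  weight-superadditive (suc f) (suc a) zero u rewrite +-identityʳ a = ≤-reflexive (+-identityʳ _)
  weight-superadditive (suc f) (suc a) (suc b) u = begin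
    suc a + ∑ (below a) (reps T) + (suc b + ∑ (below b) (reps T))
      ≡⟨ interchange (suc a) (∑ (below a) (reps T)) (suc b) (∑ (below b) (reps T)) ⟩
    suc a + suc b + (∑ (below a) (reps T) + ∑ (below b) (reps T))
      ≡⟨ cong (suc a + suc b +_) (∑-+ (below a) (below b) (reps T)) ⟨
    suc a + suc b + ∑ (λ r → below a r + below b r) (reps T)
      ≤⟨ +-monoʳ-≤ (suc a + suc b) (∑-mono pointwise (reps T)) ⟩
    suc a + suc b + ∑ (below (a + suc b)) (reps T) ∎
    where
    open ≤-Reasoning
    below : ℕ → Tup → ℕ
    below j r = ⟦ edgeG u r ⟧ * weight f (next j r) r
    interchange : ∀ a b c d → a + b + (c + d) ≡ a + c + (b + d)
    interchange = solve-∀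
    -- Monotonicity in the number is itself a consequence of this lemma, so its instance is obtained
    -- here by splitting off the difference as a further summand.
    step : ∀ r → weight f (next a r) r + weight f (next b r) r ≤ weight f (next (a + suc b) r) r
    step r = begin
      weight f (next a r) r + weight f (next b r) r
        ≤⟨ weight-superadditive f (next a r) (next b r) r ⟩
      weight f (next a r + next b r) r
        ≤⟨ m≤m+n _ _ ⟩
      weight f (next a r + next b r) r + weight f (next (a + suc b) r ∸ (next a r + next b r)) r
        ≤⟨ weight-superadditive f (next a r + next b r) _ r ⟩
      weight f (next a r + next b r + (next (a + suc b) r ∸ (next a r + next b r))) r
        ≡⟨ cong (λ n → weight f n r) (m+[n∸m]≡n (≤-trans (divOr0-+ (indeg r) a b) (divOr0-mono r))) ⟩
      weight f (next (a + suc b) r) r ∎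
      where
      -- The predecessor of `suc a + suc b` is `a + suc b`, one more than the `a + b` that comes
      -- from adding the two dividends.
      divOr0-mono : ∀ r → next (a + b) r ≤ next (a + suc b) r
      divOr0-mono r rewrite +-suc a b = ≤-trans (m≤n+m _ (divOr0 1 (indeg r))) (divOr0-+ (indeg r) 1 (a + b))
    pointwise : ∀ r → below a r + below b r ≤ below (a + suc b) r
    pointwise r = begin
      below a r + below b r
        ≡⟨ *-distribˡ-+ ⟦ edgeG u r ⟧ _ _ ⟨
      ⟦ edgeG u r ⟧ * (weight f (next a r) r + weight f (next b r) r)
        ≤⟨ *-monoʳ-≤ ⟦ edgeG u r ⟧ (step r) ⟩
      below (a + suc b) r ∎

  weight-mono : ∀ f {a b} u → a ≤ b → weight f a u ≤ weight f b u
  weight-mono f {a} {b} u a≤b = begin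
    weight f a u                       ≤⟨ m≤m+n _ _ ⟩
    weight f a u + weight f (b ∸ a) u  ≤⟨ weight-superadditive f a (b ∸ a) u ⟩
    weight f (a + (b ∸ a)) u           ≡⟨ cong (λ n → weight f n u) (m+[n∸m]≡n a≤b) ⟩
    weight f b u                       ∎
    where open ≤-Reasoning

  weight-* : ∀ f n a u → n * weight f a u ≤ weight f (n * a) u
  weight-* f zero a u = z≤n
  weight-* f (suc n) a u = ≤-trans (+-monoʳ-≤ (weight f a u) (weight-* f n a u)) (weight-superadditive f a (n * a) u)

  indeg-∑ : ∀ r → ∑ (λ u → ⟦ edgeG u r ⟧) (reps T) ≡ indeg r
  indeg-∑ r = trans (sym (countL-∑ (λ u → edgeG u r) (reps T))) (sym (countClasses-reps (λ u → edgeG u r)))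

  -- Swapping the sums collects, for each class `r`, the subtrees hanging below all its
  -- in-neighbours. There are `indeg r` of them, each with number `next j r`, and superadditivity
  -- bounds their total by a single `weight f j r`. Each level thus adds at most `n * suc j`, and
  -- these terms sum to at most `n * (i * i)`.
  ∑-weight : ∀ f i → ∑ (weight f i) (reps T) ≤ length (reps T) * (i * i)
  ∑-weight zero i = ≤-trans (≤-reflexive (∑-zero (reps T))) z≤n
  ∑-weight (suc f) zero = ≤-trans (≤-reflexive (∑-zero (reps T))) z≤n
  ∑-weight (suc f) (suc j) = begin
    ∑ (weight (suc f) (suc j)) (reps T)
      ≡⟨ ∑-+ (λ _ → suc j) (λ u → ∑ (λ r → ⟦ edgeG u r ⟧ * weight f (next j r) r) (reps T)) (reps T) ⟩
    ∑ (λ _ → suc j) (reps T) + ∑ (λ u → ∑ (λ r → ⟦ edgeG u r ⟧ * weight f (next j r) r) (reps T)) (reps T)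
      ≡⟨ cong₂ _+_ (∑-const (suc j) (reps T)) (∑-swap (λ u r → ⟦ edgeG u r ⟧ * weight f (next j r) r) (reps T) (reps T)) ⟩
    n * suc j + ∑ (λ r → ∑ (λ u → ⟦ edgeG u r ⟧ * weight f (next j r) r) (reps T)) (reps T)
      ≤⟨ +-monoʳ-≤ (n * suc j) (∑-mono fold (reps T)) ⟩
    n * suc j + ∑ (weight f j) (reps T)
      ≤⟨ +-monoʳ-≤ (n * suc j) (∑-weight f j) ⟩
    n * suc j + n * (j * j)
      ≤⟨ m≤m+n _ (n * j) ⟩
    n * suc j + n * (j * j) + n * j
      ≡⟨ square n j ⟩
    n * (suc j * suc j) ∎
    where
    open ≤-Reasoning
    n : ℕ
    n = length (reps T)
    square : ∀ n j → n * suc j + n * (j * j) + n * j ≡ n * (suc j * suc j)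
    square = solve-∀
    fold : ∀ r → ∑ (λ u → ⟦ edgeG u r ⟧ * weight f (next j r) r) (reps T) ≤ weight f j r
    fold r = begin
      ∑ (λ u → ⟦ edgeG u r ⟧ * weight f (next j r) r) (reps T)
        ≡⟨ ∑-*ʳ (λ u → ⟦ edgeG u r ⟧) (weight f (next j r) r) (reps T) ⟩
      ∑ (λ u → ⟦ edgeG u r ⟧) (reps T) * weight f (next j r) r
        ≡⟨ cong (_* weight f (next j r) r) (indeg-∑ r) ⟩
      indeg r * weight f (next j r) r
        ≤⟨ weight-* f (indeg r) (next j r) r ⟩
      weight f (indeg r * next j r) r
        ≤⟨ weight-mono f r (*-divOr0-≤ (indeg r) j) ⟩
      weight f j r ∎

  -- Moves a quantity from an arbitrary tuple to the representative of its class, so that it can be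
  -- compared termwise with sums over `reps T`.
  ∑-class : ∀ w c → ∑ (λ r → ⟦ sim w r ⟧ * c) (reps T) ≡ c
  ∑-class w c = begin
    ∑ (λ r → ⟦ sim w r ⟧ * c) (reps T)   ≡⟨ ∑-*ʳ (λ r → ⟦ sim w r ⟧) c (reps T) ⟩
    ∑ (λ r → ⟦ sim w r ⟧) (reps T) * c   ≡⟨ cong (_* c) (trans (sym (countL-∑ (sim w) (reps T))) (countL-reps-T w)) ⟩
    1 * c                                ≡⟨ *-identityˡ c ⟩
    c                                    ∎
    where open ≡-Reasoning

  size : ℕ → Tup → ℕ
  size i = weight i i

  size-bound : ∀ i u → size i u ≤ length T * (i * i)
  size-bound i u = begin
    size i u                                     ≡⟨ ∑-class u (size i u) ⟨
    ∑ (λ r → ⟦ sim u r ⟧ * size i u) (reps T)    ≤⟨ ∑-mono single (reps T) ⟩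
    ∑ (size i) (reps T)                          ≤⟨ ∑-weight i i ⟩
    length (reps T) * (i * i)                    ≤⟨ *-monoˡ-≤ (i * i) (length-reps T) ⟩
    length T * (i * i)                           ∎
    where
    open ≤-Reasoning
    single : ∀ r → ⟦ sim u r ⟧ * size i u ≤ size i r
    single r with sim u r in u~r
    ... | true = ≤-reflexive (trans (*-identityˡ _) (weight-cong i i u~r))
    ... | false = z≤n

  childSize : ℕ → Tup → ℕ
  childSize j e = size (next j e) e

  size-suc : ∀ j u → size (suc j) u ≡ suc j + ∑ (λ r → ⟦ edgeG u r ⟧ * childSize j r) (reps T)
  size-suc j u = cong (suc j +_) (∑-cong (λ r → cong (⟦ edgeG u r ⟧ *_)
    (weight-fuel j (next j r) (next j r) r (next-≤ j r) ≤-refl)) (reps T))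

  childSize-cong : ∀ j {e e′} → sim e e′ ≡ true → childSize j e ≡ childSize j e′
  childSize-cong j {e} {e′} h = trans (cong (λ n → size n e) (next-cong j h)) (weight-cong (next j e′) (next j e′) h)

  ⟦sim⟧-≤ : ∀ {u e} → edgeG u e ≡ true → ∀ j r → ⟦ sim e r ⟧ * childSize j e ≤ ⟦ edgeG u r ⟧ * childSize j r
  ⟦sim⟧-≤ {u} {e} ue j r with sim e r in e~r
  ... | true rewrite trans (sym (edgeG-congʳ e~r u)) ue = ≤-reflexive (cong (1 *_) (childSize-cong j e~r))
  ... | false = z≤n

  size-child : ∀ {u e} j → edgeG u e ≡ true → childSize j e < size (suc j) u
  size-child {u} {e} j ue = begin-strict
    childSize j e                                                ≡⟨ ∑-class e (childSize j e) ⟨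
    ∑ (λ r → ⟦ sim e r ⟧ * childSize j e) (reps T)               ≤⟨ ∑-mono (⟦sim⟧-≤ ue j) (reps T) ⟩
    ∑ (λ r → ⟦ edgeG u r ⟧ * childSize j r) (reps T)             <⟨ m<n+m _ (s≤s z≤n) ⟩
    suc j + ∑ (λ r → ⟦ edgeG u r ⟧ * childSize j r) (reps T)     ≡⟨ size-suc j u ⟨
    size (suc j) u                                               ∎
    where open ≤-Reasoning

  -- Inequivalent children occupy different summands in the size of their parent. With one of them
  -- on a path, this bounds the size of the other.
  size-children : ∀ {u e e′} j → edgeG u e ≡ true → edgeG u e′ ≡ true → sim e e′ ≡ false →
    childSize j e + childSize j e′ < size (suc j) u
  size-children {u} {e} {e′} j ue ue′ e≁e′ = begin-strict
    childSize j e + childSize j e′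
      ≡⟨ cong₂ _+_ (∑-class e (childSize j e)) (∑-class e′ (childSize j e′)) ⟨
    ∑ (λ r → ⟦ sim e r ⟧ * childSize j e) (reps T) + ∑ (λ r → ⟦ sim e′ r ⟧ * childSize j e′) (reps T)
      ≡⟨ ∑-+ (λ r → ⟦ sim e r ⟧ * childSize j e) (λ r → ⟦ sim e′ r ⟧ * childSize j e′) (reps T) ⟨
    ∑ (λ r → ⟦ sim e r ⟧ * childSize j e + ⟦ sim e′ r ⟧ * childSize j e′) (reps T)
      ≤⟨ ∑-mono disjoint (reps T) ⟩
    ∑ (λ r → ⟦ edgeG u r ⟧ * childSize j r) (reps T)
      <⟨ m<n+m _ (s≤s z≤n) ⟩
    suc j + ∑ (λ r → ⟦ edgeG u r ⟧ * childSize j r) (reps T)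
      ≡⟨ size-suc j u ⟨
    size (suc j) u ∎
    where
    open ≤-Reasoning
    disjoint : ∀ r → ⟦ sim e r ⟧ * childSize j e + ⟦ sim e′ r ⟧ * childSize j e′ ≤ ⟦ edgeG u r ⟧ * childSize j r
    disjoint r with sim e′ r in e′~r
    ... | false = ≤-trans (≤-reflexive (+-identityʳ _)) (⟦sim⟧-≤ ue j r)
    ... | true with sim e r in e~r
    ... | false = subst (λ b → ⟦ b ⟧ * childSize j e′ ≤ ⟦ edgeG u r ⟧ * childSize j r) e′~r (⟦sim⟧-≤ ue′ j r)
    ... | true = contradiction (trans (sym (sim-trans e~r (sim-sym e′~r))) e≁e′) λ ()

-- Certificates for the values in a computation tree, and their soundness.

module Certificates (s k ℓ M : ℕ)
  (eq E : Vec (Fin s) k → Vec (Fin s) k → Bool)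
  (C : Vec (Fin s) k → Vec (Fin (suc s)) ℓ → Bool) where

  open LRecSem s k ℓ eq E C
  open Quotient s k ℓ eq E C

  bools : List Bool
  bools = true ∷ false ∷ []

  ∈-bools : ∀ b → b ∈ bools
  ∈-bools true = here refl
  ∈-bools false = there (here refl)

  -- `W x e` stands for "child `e` is certified to have value `x`" and may hold for neither value.
  -- The first conjunct excludes this, since an undecided child would silently be counted as false.
  localCheck : (Bool → Tup → Bool) → Tup → Bool → Bool
  localCheck W w y =
    not (any (λ e → edgeG w e ∧ not (W true e ∨ W false e)) T) ∧
    (inC w (countBySize λ e → edgeG w e ∧ W true e) == y)

  nodeCheck : (Bool → ℕ → Tup → Bool) → Bool → ℕ → Tup → Bool
  -- Membership in X requires a positive number, so the value at number 0 is false.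
  nodeCheck U y zero w = not y
  nodeCheck U y (suc j) w = localCheck (λ x e → U x (next j e) e) w y

  assuming : Bool → Tup → (Bool → Tup → Bool) → Bool → Tup → Bool
  assuming z w W x e = if sim e w then x == z else W x e

  -- The hypothesis of a conditional certificate is discharged at a node `w` whose children are
  -- certified outright.
  throughNode : (Bool → ℕ → Bool → ℕ → Tup → Tup → Bool) → (Bool → ℕ → Tup → Bool) → Bool → ℕ → Tup → Bool
  throughNode R U x i u =
    any (λ y → any (λ j → any (λ w → R x i y j u w ∧ nodeCheck U y j w) T) (upTo (suc M))) bools

  -- A conditional certificate cut at the edge from `w` to `w′`: conditional certificates above and
  -- below it, and in between the local check at `w`, with the value of `w′` assumed and the other
  -- children certified outright.
  via : (Bool → ℕ → Bool → ℕ → Tup → Tup → Bool) → (Bool → ℕ → Tup → Bool) →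
    Bool → ℕ → Bool → ℕ → Bool → Bool → ℕ → Tup → Tup → Tup → Tup → Bool
  via R U x i y j z z′ l u v w w′ =
    (R x i z (suc l) u w ∧ R z′ (next l w′) y j w′ v) ∧
    (edgeG w w′ ∧ localCheck (assuming z′ w′ (λ b e → U b (next l e) e)) w z)

  throughEdge : (Bool → ℕ → Bool → ℕ → Tup → Tup → Bool) → (Bool → ℕ → Tup → Bool) →
    Bool → ℕ → Bool → ℕ → Tup → Tup → Bool
  throughEdge R U x i y j u v =
    any (λ z → any (λ z′ → any (λ l → any (λ w → any (λ w′ →
      via R U x i y j z z′ l u v w w′) T) T) (upTo M)) bools) bools

  -- valued t x i u certifies that the value of ([u], i) is x; it finds all nodes of size below 2 ^ t.
  -- implied t x i y j u v certifies that this value is x provided that ([v], j) has value y; it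
  -- finds all descendants v whose size is less than 2 ^ t below that of u.
  mutual
    valued : ℕ → Bool → ℕ → Tup → Bool
    valued zero x i u = (i ≡ᵇ 0) ∧ not x
    valued (suc t) = throughNode (implied t) (valued t)

    implied : ℕ → Bool → ℕ → Bool → ℕ → Tup → Tup → Bool
    implied zero x i y j u v = (x == y) ∧ ((i ≡ᵇ j) ∧ sim u v)
    implied (suc t) x i y j u v =
      -- `valued (suc t)` rather than `valued t`: the siblings hanging off the path may have any
      -- size below `2 ^ suc t`.
      implied t x i y j u v ∨ throughEdge (implied t) (valued (suc t)) x i y j u v

  Sound : ℕ → Tup → (Bool → Tup → Bool) → Set
  Sound j w W = ∀ x e → edgeG w e ≡ true → W x e ≡ true → X e (next j e) ≡ x

  Complete : ℕ → Tup → (Bool → Tup → Bool) → Set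
  Complete j w W = ∀ e → edgeG w e ≡ true → W (X e (next j e)) e ≡ true

  child-count : ∀ j w W → Sound j w W → Complete j w W →
    inC w (countBySize λ e → edgeG w e ∧ W true e) ≡ X w (suc j)
  child-count j w W sound complete = begin
    inC w (countBySize λ e → edgeG w e ∧ W true e)
      ≡⟨ cong (inC w) (countBySize-cong agree) ⟩
    inC w (countBySize λ e → edgeG w e ∧ X e (next j e))
      ≡⟨ cong (inC w) (countBySize≡countClasses _ (λ h → cong₂ _∧_ (edgeG-congʳ h w) (X-next-cong j h))) ⟩
    inC w (countClasses λ e → edgeG w e ∧ X e (next j e))
      ≡⟨ X-suc w j ⟨
    X w (suc j) ∎
    where
    open ≡-Reasoning
    agree : ∀ e → edgeG w e ∧ W true e ≡ edgeG w e ∧ X e (next j e)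
    agree e with edgeG w e in we
    ... | false = refl
    ... | true = bool-ext (sound true e we) λ Xe → subst (λ x → W x e ≡ true) Xe (complete e we)

  -- The first conjunct certifies every child with some value, and by soundness with the true one.
  -- Completeness at the children thus comes from the check itself, without a bound on sizes.
  localCheck-sound : ∀ j w W {y} → Sound j w W → localCheck W w y ≡ true → X w (suc j) ≡ y
  localCheck-sound j w W {y} sound h with ∧-elim h
  ... | decided , gate = trans (sym (child-count j w W sound complete)) (==-sound gate)
    where
    complete : Complete j w W
    complete e we with W true e in W₁ | W false e in W₀
    ... | true | _ = trans (cong (λ x → W x e) (sound true e we W₁)) W₁
    ... | false | true = trans (cong (λ x → W x e) (sound false e we W₀)) W₀
    ... | false | false = contradiction (trans (sym decided) (cong not (any-intro _ (∈-tuples e) undecided))) λ ()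
      where
      undecided : edgeG w e ∧ not (W true e ∨ W false e) ≡ true
      undecided rewrite we | W₁ | W₀ = refl

  localCheck-complete : ∀ j w W → Sound j w W → Complete j w W → localCheck W w (X w (suc j)) ≡ true
  localCheck-complete j w W sound complete = ∧-intro decided
    (subst (λ b → (b == X w (suc j)) ≡ true) (sym (child-count j w W sound complete)) (==-refl (X w (suc j))))
    where
    W-or : ∀ b e → W b e ≡ true → W true e ∨ W false e ≡ true
    W-or true e h = ∨-introˡ h
    W-or false e h = ∨-introʳ {W true e} h
    decided : not (any (λ e → edgeG w e ∧ not (W true e ∨ W false e)) T) ≡ true
    decided with any (λ e → edgeG w e ∧ not (W true e ∨ W false e)) T in h
    ... | false = refl
    ... | true with any-elim _ T h
    ... | e , _ , he with ∧-elim {edgeG w e} he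
    ... | we , undecided = contradiction (trans (sym undecided) (cong not (W-or _ e (complete e we)))) λ ()

  nodeCheck-sound : ∀ U → (∀ x i u → U x i u ≡ true → X u i ≡ x) →
    ∀ {y} j w → nodeCheck U y j w ≡ true → X w j ≡ y
  nodeCheck-sound U sound {false} zero w h = refl
  nodeCheck-sound U sound (suc j) w h =
    localCheck-sound j w (λ x e → U x (next j e) e) (λ x e _ → sound x (next j e) e) h

  assuming-sound : ∀ j w z w′ W → X w′ (next j w′) ≡ z → Sound j w W → Sound j w (assuming z w′ W)
  assuming-sound j w z w′ W hz sound x e we h with sim e w′ in e~w′
  ... | true = trans (X-next-cong j e~w′) (trans hz (sym (==-sound h)))
  ... | false = sound x e we h

  ValuedSound : (Bool → ℕ → Tup → Bool) → Set
  ValuedSound U = ∀ x i u → U x i u ≡ true → X u i ≡ x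

  ImpliedSound : (Bool → ℕ → Bool → ℕ → Tup → Tup → Bool) → Set
  ImpliedSound R = ∀ x i y j u v → R x i y j u v ≡ true → X v j ≡ y → X u i ≡ x

  throughNode-sound : ∀ R U → ImpliedSound R → ValuedSound U → ValuedSound (throughNode R U)
  throughNode-sound R U R-sound U-sound x i u h
    with any-elim (λ y → any (λ j → any (λ w → R x i y j u w ∧ nodeCheck U y j w) T) (upTo (suc M))) bools h
  ... | y , _ , h₁ with any-elim (λ j → any (λ w → R x i y j u w ∧ nodeCheck U y j w) T) (upTo (suc M)) h₁
  ... | j , _ , h₂ with any-elim (λ w → R x i y j u w ∧ nodeCheck U y j w) T h₂
  ... | w , _ , h₃ with ∧-elim {R x i y j u w} h₃
  ... | imp , node = R-sound x i y j u w imp (nodeCheck-sound U U-sound j w node)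

  throughNode-intro : ∀ R U x i u y j w → j ≤ M → R x i y j u w ≡ true → nodeCheck U y j w ≡ true →
    throughNode R U x i u ≡ true
  throughNode-intro R U x i u y j w j≤M h h′ =
    any-intro (λ y → any (λ j → any (P y j) T) (upTo (suc M))) (∈-bools y)
      (any-intro (λ j → any (P y j) T) (∈-upTo⁺ (s≤s j≤M))
        (any-intro (P y j) (∈-tuples w) (∧-intro h h′)))
    where
    P : Bool → ℕ → Tup → Bool
    P y j w = R x i y j u w ∧ nodeCheck U y j w

  via-sound : ∀ R U → ImpliedSound R → ValuedSound U →
    ∀ x i y j z z′ l u v w w′ → via R U x i y j z z′ l u v w w′ ≡ true → X v j ≡ y → X u i ≡ x
  via-sound R U R-sound U-sound x i y j z z′ l u v w w′ h hv
    with ∧-elim {R x i z (suc l) u w ∧ R z′ (next l w′) y j w′ v} h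
  ... | h₁ , h₂ with ∧-elim {R x i z (suc l) u w} h₁ | ∧-elim {edgeG w w′} h₂
  ... | upper , lower | _ , local =
    R-sound x i z (suc l) u w upper
      (localCheck-sound l w (assuming z′ w′ (λ b e → U b (next l e) e))
        (assuming-sound l w z′ w′ (λ b e → U b (next l e) e) (R-sound z′ (next l w′) y j w′ v lower hv)
          λ b e _ → U-sound b (next l e) e)
        local)

  throughEdge-sound : ∀ R U → ImpliedSound R → ValuedSound U → ImpliedSound (throughEdge R U)
  throughEdge-sound R U R-sound U-sound x i y j u v h hv
    with any-elim (λ z → any (λ z′ → any (λ l → any (λ w → any (P z z′ l w) T) T) (upTo M)) bools) bools h
    where
    P : Bool → Bool → ℕ → Tup → Tup → Bool
    P z z′ l = via R U x i y j z z′ l u v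
  ... | z , _ , h₁ with any-elim (λ z′ → any (λ l → any (λ w → any (via R U x i y j z z′ l u v w) T) T) (upTo M)) bools h₁
  ... | z′ , _ , h₂ with any-elim (λ l → any (λ w → any (via R U x i y j z z′ l u v w) T) T) (upTo M) h₂
  ... | l , _ , h₃ with any-elim (λ w → any (via R U x i y j z z′ l u v w) T) T h₃
  ... | w , _ , h₄ with any-elim (via R U x i y j z z′ l u v w) T h₄
  ... | w′ , _ , h₅ = via-sound R U R-sound U-sound x i y j z z′ l u v w w′ h₅ hv

  throughEdge-intro : ∀ R U x i y j u v z z′ l w w′ → l < M → via R U x i y j z z′ l u v w w′ ≡ true →
    throughEdge R U x i y j u v ≡ true
  throughEdge-intro R U x i y j u v z z′ l w w′ l<M h =
    any-intro (λ z → any (λ z′ → any (λ l → any (λ w → any (P z z′ l w) T) T) (upTo M)) bools) (∈-bools z)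
      (any-intro (λ z′ → any (λ l → any (λ w → any (P z z′ l w) T) T) (upTo M)) (∈-bools z′)
        (any-intro (λ l → any (λ w → any (P z z′ l w) T) T) (∈-upTo⁺ l<M)
          (any-intro (λ w → any (P z z′ l w) T) (∈-tuples w) (any-intro (P z z′ l w) (∈-tuples w′) h))))
    where
    P : Bool → Bool → ℕ → Tup → Tup → Bool
    P z z′ l = via R U x i y j z z′ l u v

  mutual
    valued-sound : ∀ t → ValuedSound (valued t)
    valued-sound zero false i u h with ≡ᵇ-sound i 0 (proj₁ (∧-elim {i ≡ᵇ 0} h))
    ... | refl = refl
    valued-sound zero true i u h = contradiction (proj₂ (∧-elim {i ≡ᵇ 0} h)) λ ()
    valued-sound (suc t) = throughNode-sound (implied t) (valued t) (implied-sound t) (valued-sound t)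

    implied-sound : ∀ t → ImpliedSound (implied t)
    implied-sound zero x i y j u v h hv with ∧-elim {x == y} h
    ... | x==y , h′ with ∧-elim {i ≡ᵇ j} h′
    ... | i==j , u~v with ==-sound {x} x==y | ≡ᵇ-sound i j i==j
    ... | refl | refl = trans (X-cong i u~v) hv
    implied-sound (suc t) x i y j u v h hv = [
      (λ h′ → implied-sound t x i y j u v h′ hv) ,
      (λ h′ → throughEdge-sound (implied t) (valued (suc t)) (implied-sound t) (valued-sound (suc t)) x i y j u v h′ hv)
      ]′ (∨-elim h)

  -- Completeness of the certificates for trees of bounded size.

  data Path : ℕ → Tup → ℕ → Tup → Set where
    stop : ∀ {i u} → Path i u i u
    step : ∀ {i u j v w} → edgeG u w ≡ true → Path (next i w) w j v → Path (suc i) u j v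

  path-≤ : ∀ {i u j v} → Path i u j v → j ≤ i
  path-≤ stop = ≤-refl
  path-≤ (step {i} {w = w} _ p) = ≤-trans (path-≤ p) (m≤n⇒m≤1+n (next-≤ i w))

  path-size : ∀ {i u j v} → Path i u j v → size j v ≤ size i u
  path-size stop = ≤-refl
  path-size (step {i} uw p) = ≤-trans (path-size p) (<⇒≤ (size-child i uw))

  Light : ℕ → ℕ → Tup → Set
  Light B j w = ∀ {l} → j ≡ suc l → ∀ e → edgeG w e ≡ true → childSize l e < B

  -- Descend into a child of size at least B as long as there is one.
  heavy-path : ∀ f B S i u → i ≤ f → S < B + B → S < B + size i u →
    ∃ λ j → ∃ λ w → Path i u j w × Light B j w × S < B + size j w
  heavy-path f B S zero u _ _ S< = 0 , u , stop , (λ ()) , S<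
  heavy-path (suc f) B S (suc i) u (s≤s i≤f) S<2B S<
    with any (λ e → edgeG u e ∧ (B ≤ᵇ childSize i e)) T in h
  ... | false = suc i , u , stop , light , S<
    where
    light : Light B (suc i) u
    light refl e ue with childSize i e <? B
    ... | yes lt = lt
    ... | no ≥B = contradiction
      (trans (sym h) (any-intro _ (∈-tuples e) (∧-intro ue (≤ᵇ-true (≮⇒≥ ≥B))))) λ ()
  ... | true with any-elim _ T h
  ... | e , _ , he with ∧-elim {edgeG u e} he
  -- The bound `S < B + size` renews itself at any child of size at least `B`, because `S < B + B`.
  ... | ue , B≤ with heavy-path f B S (next i e) e (≤-trans (next-≤ i e) i≤f) S<2B
                       (<-≤-trans S<2B (+-monoʳ-≤ B (≤ᵇ-sound B _ B≤)))
  ... | j , w , p , light , S<′ = j , w , step ue p , light , S<′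

  -- Sizes decrease along the path from above `S - B` to at most `S - B`, so some edge crosses this
  -- threshold; subtraction is avoided by adding `B` on the other side.
  split-path : ∀ B S {i u j v} → Path i u j v → S < B + size i u → B + size j v ≤ S →
    ∃ λ l → ∃ λ w → ∃ λ w′ → Path i u (suc l) w × edgeG w w′ ≡ true × Path (next l w′) w′ j v ×
      S < B + size (suc l) w × B + childSize l w′ ≤ S
  split-path B S stop S< ≤S = contradiction ≤S (<⇒≱ S<)
  split-path B S {u = u} (step {i} {w = w} uw p) S< ≤S with B + childSize i w ≤? S
  ... | yes w≤S = i , u , w , stop , uw , p , S< , w≤S
  ... | no w≰S with split-path B S p (≰⇒> w≰S) ≤S
  ... | l , x , x′ , p₁ , xx′ , p₂ , S<′ , ≤S′ = l , x , x′ , step uw p₁ , xx′ , p₂ , S<′ , ≤S′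

  1≤2^ : ∀ t → 1 ≤ 2 ^ t
  1≤2^ t = m^n>0 2 t

  2^suc : ∀ t → 2 ^ suc t ≡ 2 ^ t + 2 ^ t
  2^suc t = cong (2 ^ t +_) (+-identityʳ (2 ^ t))

  ValuedComplete : ℕ → (Bool → ℕ → Tup → Bool) → Set
  ValuedComplete t U = ∀ i u → i ≤ M → size i u < 2 ^ t → U (X u i) i u ≡ true

  ImpliedComplete : ℕ → (Bool → ℕ → Bool → ℕ → Tup → Tup → Bool) → Set
  ImpliedComplete t R = ∀ i u j v → i ≤ M → Path i u j v → size i u < 2 ^ t + size j v →
    R (X u i) i (X v j) j u v ≡ true

  nodeCheck-complete : ∀ t U → ValuedSound U → ValuedComplete t U →
    ∀ j w → j ≤ M → Light (2 ^ t) j w → nodeCheck U (X w j) j w ≡ true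
  nodeCheck-complete t U U-sound U-complete zero w _ _ = refl
  nodeCheck-complete t U U-sound U-complete (suc j) w j<M light =
    localCheck-complete j w (λ x e → U x (next j e) e)
      (λ x e _ → U-sound x (next j e) e)
      (λ e we → U-complete (next j e) e (≤-trans (next-≤ j e) (<⇒≤ j<M)) (light refl e we))

  -- The end of the heavy path meets both demands: less than `2 ^ t` of the size is lost on the way
  -- to it, and all its children are smaller than `2 ^ t`.
  throughNode-complete : ∀ t R U → ImpliedComplete t R → ValuedSound U → ValuedComplete t U →
    ValuedComplete (suc t) (throughNode R U)
  throughNode-complete t R U R-complete U-sound U-complete i u i≤M h
    with heavy-path i (2 ^ t) (size i u) i u ≤-refl (subst (size i u <_) (2^suc t) h)
           (m<n+m (size i u) (1≤2^ t))
  ... | j , w , p , light , S< =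
    throughNode-intro R U (X u i) i u (X w j) j w (≤-trans (path-≤ p) i≤M)
      (R-complete i u j w i≤M p S<)
      (nodeCheck-complete t U U-sound U-complete j w (≤-trans (path-≤ p) i≤M) light)

  throughEdge-complete : ∀ t R U → ImpliedComplete t R → ValuedSound U → ValuedComplete (suc t) U →
    ∀ i u j v → i ≤ M → Path i u j v → size i u < 2 ^ suc t + size j v → 2 ^ t + size j v ≤ size i u →
    throughEdge R U (X u i) i (X v j) j u v ≡ true
  throughEdge-complete t R U R-complete U-sound U-complete i u j v i≤M p h h≥
    with split-path (2 ^ t) (size i u) p (m<n+m (size i u) (1≤2^ t)) h≥
  ... | l , w , w′ , p₁ , ww′ , p₂ , S< , ≤S =
    throughEdge-intro R U (X u i) i (X v j) j u v (X w (suc l)) (X w′ (next l w′)) l w w′ l<M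
      (∧-intro
        (∧-intro (R-complete i u (suc l) w i≤M p₁ S<)
          (R-complete (next l w′) w′ j v (≤-trans (next-≤ l w′) (<⇒≤ l<M)) p₂ lower))
        (∧-intro ww′ (localCheck-complete l w (assuming (X w′ (next l w′)) w′ children)
          (assuming-sound l w (X w′ (next l w′)) w′ children refl (λ x e _ → U-sound x (next l e) e))
          siblings)))
    where
    children : Bool → Tup → Bool
    children b e = U b (next l e) e
    l<M : l < M
    l<M = ≤-trans (path-≤ p₁) i≤M
    h′ : size i u < 2 ^ t + (2 ^ t + size j v)
    h′ = subst (size i u <_) (trans (cong (_+ size j v) (2^suc t)) (+-assoc (2 ^ t) _ _)) h
    lower : size (next l w′) w′ < 2 ^ t + size j v
    lower = +-cancelˡ-< (2 ^ t) _ _ (≤-<-trans ≤S h′)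
    -- The subtree of `v` lies inside that of `w′`, so `size j v` is lost to the sibling and cancels
    -- from the bound on `size i u`.
    sibling-size : ∀ e → edgeG w e ≡ true → sim e w′ ≡ false → childSize l e < 2 ^ suc t
    sibling-size e we e≁w′ = +-cancelʳ-< (size j v) _ _ (begin-strict
      childSize l e + size j v         ≤⟨ +-monoʳ-≤ (childSize l e) (path-size p₂) ⟩
      childSize l e + childSize l w′   <⟨ size-children l we ww′ e≁w′ ⟩
      size (suc l) w                   ≤⟨ path-size p₁ ⟩
      size i u                         <⟨ h ⟩
      2 ^ suc t + size j v             ∎)
      where open ≤-Reasoning
    siblings : Complete l w (assuming (X w′ (next l w′)) w′ children)
    siblings e we with sim e w′ in e~w′
    ... | true = subst (λ x → (X e (next l e) == x) ≡ true) (X-next-cong l e~w′) (==-refl (X e (next l e)))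
    ... | false = U-complete (next l e) e (≤-trans (next-≤ l e) (<⇒≤ l<M)) (sibling-size e we e~w′)

  mutual
    valued-complete : ∀ t → ValuedComplete t (valued t)
    valued-complete zero zero u _ _ = refl
    valued-complete zero (suc i) u _ h = contradiction (≤-trans (s≤s z≤n) (≤-reflexive (sym (size-suc i u)))) (<⇒≱ h)
    valued-complete (suc t) =
      throughNode-complete t (implied t) (valued t) (implied-complete t) (valued-sound t) (valued-complete t)

    implied-complete : ∀ t → ImpliedComplete t (implied t)
    implied-complete zero i u .i .u i≤M stop h =
      ∧-intro (==-refl (X u i)) (∧-intro (≡ᵇ-refl i) (sim-refl u))
    -- A step strictly lowers the size, so with `2 ^ 0 = 1` only the empty path is in range.
    implied-complete zero (suc i) u j v i≤M (step uw p) h =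
      contradiction (≤-trans (s≤s (path-size p)) (size-child i uw)) (<⇒≱ h)
    implied-complete (suc t) i u j v i≤M p h = [
      (λ lt → ∨-introˡ (implied-complete t i u j v i≤M p lt)) ,
      (λ ge → ∨-introʳ {implied t (X u i) i (X v j) j u v}
        (throughEdge-complete t (implied t) (valued (suc t)) (implied-complete t) (valued-sound (suc t))
          (valued-complete (suc t)) i u j v i≤M p h ge))
      ]′ (<-≤-connex (size i u) (2 ^ t + size j v))

  valued≡X : ∀ t i u → i ≤ M → size i u < 2 ^ t → valued t true i u ≡ X u i
  valued≡X t i u i≤M h = bool-ext (valued-sound t true i u)
    (λ Xui → subst (λ x → valued t x i u ≡ true) Xui (valued-complete t i u i≤M h))

-- Definability with boundedly many variables and bounded quantifier depth.

-- Contexts: one tuple of variables (or of their values) for each entry of ks.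
Ctx : Set → List ℕ → Set
Ctx X [] = ⊤
Ctx X (k ∷ ks) = Vec X k × Ctx X ks

mapC : ∀ {X Y} → (X → Y) → ∀ {ks} → Ctx X ks → Ctx Y ks
mapC f {[]} _ = tt
mapC f {k ∷ ks} (xs , c) = V.map f xs , mapC f c

entries : ∀ {X ks} → Ctx X ks → List X
entries {ks = []} _ = []
entries {ks = k ∷ ks} (xs , c) = V.toList xs ++ entries c

length-entries : ∀ {X ks} (c : Ctx X ks) → length (entries c) ≡ sum ks
length-entries {ks = []} _ = refl
length-entries {ks = k ∷ ks} (xs , c) =
  trans (L.length-++ (V.toList xs)) (cong₂ _+_ (V.length-toList xs) (length-entries c))

mapC-agree : ∀ {X Y} {f g : X → Y} {ks} (c : Ctx X ks) → (∀ x → x ∈ entries c → f x ≡ g x) → mapC f c ≡ mapC g c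
mapC-agree {ks = []} _ _ = refl
mapC-agree {f = f} {g} {k ∷ ks} (xs , c) agree =
  cong₂ _,_ (map-agree xs λ x x∈ → agree x (∈-++⁺ˡ x∈)) (mapC-agree c λ x x∈ → agree x (∈-++⁺ʳ (V.toList xs) x∈))
  where
  map-agree : ∀ {n} (xs : Vec _ n) → (∀ x → x ∈ V.toList xs → f x ≡ g x) → V.map f xs ≡ V.map g xs
  map-agree [] _ = refl
  map-agree (x ∷ xs) h = cong₂ _∷_ (h x (here refl)) (map-agree xs λ y y∈ → h y (there y∈))

-- If every variable occurred in `xs`, positions would inject `Fin K` into `Fin (length xs)`.
fresh : ∀ {K} (xs : List (Fin K)) → length xs < K → ∃ λ y → y ∉ xs
fresh {K} xs short with F.any? (λ y → ¬? (_∈?_ F._≟_ y xs))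
... | yes found = found
... | no none = contradiction short (≤⇒≯ (F.injective⇒≤ {f = λ y → Any.index (covered y)}
    (λ {y} {z} → index-injective (setoid _) (covered y) (covered z))))
  where
  covered : ∀ y → y ∈ xs
  covered y = decidable-stable (_∈?_ F._≟_ y xs) λ y∉ → none (y , y∉)

≤ᵇ-between : ∀ n m → (m ≤ᵇ n) ∧ not (suc m ≤ᵇ n) ≡ (n ≡ᵇ m)
≤ᵇ-between n m with <-cmp m n
... | tri< m<n _ _ rewrite ≤ᵇ-true (<⇒≤ m<n) | ≤ᵇ-true m<n = sym (≡ᵇ-≢ (>⇒≢ m<n))
... | tri≈ _ refl _ rewrite ≤ᵇ-true {n} ≤-refl | ≤ᵇ-false {suc n} ≤-refl = sym (≡ᵇ-refl n)
... | tri> _ _ m>n rewrite ≤ᵇ-false m>n = sym (≡ᵇ-≢ (<⇒≢ m>n))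

any-countL : ∀ {A : Set} (p : A → Bool) xs → any p xs ≡ not (countL p xs ≡ᵇ 0)
any-countL p [] = refl
any-countL p (x ∷ xs) with p x
... | true = refl
... | false = any-countL p xs

≟-refl : ∀ {n} (x : Fin n) → ⌊ x F.≟ x ⌋ ≡ true
≟-refl x = trans (isYes≗does (x F.≟ x)) (dec-true (x F.≟ x) refl)

-- Definability in C^K with quantifier depth at most q, uniformly over all structures of size s and
-- for every choice of the variables that hold the arguments.  Variables are thereby reused: only
-- the arguments of the relation at hand occupy variables.
module Definability (τ : Vocab) (s K : ℕ) (x₀ : Fin K) where

  Rel : List ℕ → Set
  Rel ks = Structure τ s → Ctx (Fin s) ks → Bool

  Term : List ℕ → Set
  Term ks = Structure τ s → Ctx (Fin s) ks → ℕ

  record Def (q : ℕ) (ks : List ℕ) (P : Rel ks) : Set where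
    field
      formula : (c : Ctx (Fin K) ks) → Σ (CF τ K) λ ψ → qdepth ψ ≤ q ×
        (∀ A β → ceval A ψ β ≡ P A (mapC (lookup β) c))
  open Def

  -- A numerical term is represented by the formulas "t = m", one for each m; the bound keeps
  -- disjunctions over its values finite.
  record Num (q : ℕ) (ks : List ℕ) (t : Term ks) : Set where
    field
      bound   : ℕ
      bounded : ∀ A c → t A c ≤ bound
      at      : ∀ m → Def q ks λ A c → t A c ≡ᵇ m
  open Num

  D-ext : ∀ {q ks} {P Q : Rel ks} → (∀ A c → P A c ≡ Q A c) → Def q ks P → Def q ks Q
  D-ext P≗Q p .formula c with p .formula c
  ... | ψ , ψ≤q , h = ψ , ψ≤q , λ A β → trans (h A β) (P≗Q A _)

  D-weaken : ∀ {q q′ ks P} → q ≤ q′ → Def q ks P → Def q′ ks P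
  D-weaken q≤q′ p .formula c with p .formula c
  ... | ψ , ψ≤q , h = ψ , ≤-trans ψ≤q q≤q′ , h

  -- `r` acts on variables in the formula and on their values in the relation, and naturality makes
  -- the two agree. Entries that `r` drops release their variables for reuse.
  D-rename : ∀ {q ks ks′ P} (r : ∀ {X} → Ctx X ks′ → Ctx X ks) →
    (∀ {X Y} (f : X → Y) c → r (mapC f c) ≡ mapC f (r c)) → Def q ks P → Def q ks′ (λ A c → P A (r c))
  D-rename {P = P} r natural p .formula c with p .formula (r c)
  ... | ψ , ψ≤q , h = ψ , ψ≤q , λ A β → trans (h A β) (cong (P A) (sym (natural (lookup β) c)))

  D-not : ∀ {q ks P} → Def q ks P → Def q ks (λ A c → not (P A c))
  D-not p .formula c with p .formula c
  ... | ψ , ψ≤q , h = neg ψ , ψ≤q , λ A β → cong not (h A β)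

  D-and : ∀ {q ks P Q} → Def q ks P → Def q ks Q → Def q ks (λ A c → P A c ∧ Q A c)
  D-and p p′ .formula c with p .formula c | p′ .formula c
  ... | ψ , ψ≤q , h | χ , χ≤q , h′ = and ψ χ , ⊔-lub ψ≤q χ≤q , λ A β → cong₂ _∧_ (h A β) (h′ A β)

  D-or : ∀ {q ks P Q} → Def q ks P → Def q ks Q → Def q ks (λ A c → P A c ∨ Q A c)
  D-or p p′ .formula c with p .formula c | p′ .formula c
  ... | ψ , ψ≤q , h | χ , χ≤q , h′ = or ψ χ , ⊔-lub ψ≤q χ≤q , λ A β → cong₂ _∨_ (h A β) (h′ A β)

  D-true : ∀ {q ks} → Def q ks (λ _ _ → true)
  D-true .formula c = eq x₀ x₀ , z≤n , λ A β → ≟-refl (lookup β x₀)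

  D-const : ∀ {q ks} b → Def q ks (λ _ _ → b)
  D-const {q} {ks} true = D-true
  D-const {q} {ks} false = D-not (D-true)

  D-if : ∀ {q ks P Q R} → Def q ks P → Def q ks Q → Def q ks R →
    Def q ks (λ A c → if P A c then Q A c else R A c)
  D-if {P = P} {Q} {R} p p′ p″ = D-ext (λ A c → if-or (P A c) (Q A c) (R A c))
    (D-or
      (D-and p p′) (D-and (D-not p) p″))
    where
    if-or : ∀ x y z → (x ∧ y) ∨ (not x ∧ z) ≡ (if x then y else z)
    if-or true true z = refl
    if-or true false z = refl
    if-or false y z = refl

  D-map : ∀ {q ks P} (f : Bool → Bool) → Def q ks P → Def q ks (λ A c → f (P A c))
  D-map {q} {ks} {P} f p = D-ext (λ A c → if-f (P A c))
    (D-if p (D-const (f true)) (D-const (f false)))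
    where
    if-f : ∀ b → (if b then f true else f false) ≡ f b
    if-f true = refl
    if-f false = refl

  D-any : ∀ {q ks} {B : Set} {P : B → Rel ks} (bs : List B) → (∀ b → Def q ks (P b)) →
    Def q ks (λ A c → any (λ b → P b A c) bs)
  D-any {q} {ks} [] p = D-const false
  D-any {P = P} (b ∷ bs) p = D-or (p b) (D-any bs p)

  N-ext : ∀ {q ks} {t u : Term ks} → (∀ A c → t A c ≡ u A c) → Num q ks t → Num q ks u
  N-ext t≗u n = record
    { bound = bound n
    ; bounded = λ A c → subst (_≤ bound n) (t≗u A c) (bounded n A c)
    ; at = λ m → D-ext (λ A c → cong (_≡ᵇ m) (t≗u A c)) (at n m)
    }

  N-weaken : ∀ {q q′ ks t} → q ≤ q′ → Num q ks t → Num q′ ks t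
  N-weaken {t = t} q≤q′ n = record
    { bound = bound n ; bounded = bounded n ; at = λ m → D-weaken q≤q′ (at n m) }

  N-rename : ∀ {q ks ks′ t} (r : ∀ {X} → Ctx X ks′ → Ctx X ks) →
    (∀ {X Y} (f : X → Y) c → r (mapC f c) ≡ mapC f (r c)) → Num q ks t → Num q ks′ (λ A c → t A (r c))
  N-rename {t = t} r natural n = record
    { bound = bound n
    ; bounded = λ A c → bounded n A (r c)
    ; at = λ m → D-rename r natural (at n m)
    }

  -- A case distinction over the values up to the bound. The depth stays `q`, so arithmetic is free.
  N-bind : ∀ {q ks t} {P : ℕ → Rel ks} → Num q ks t → (∀ m → Def q ks (P m)) →
    Def q ks (λ A c → P (t A c) A c)
  N-bind {t = t} {P} n p = D-ext correct
    (D-any (upTo (suc (bound n)))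
      λ m → D-and (at n m) (p m))
    where
    correct : ∀ A c → any (λ m → (t A c ≡ᵇ m) ∧ P m A c) (upTo (suc (bound n))) ≡ P (t A c) A c
    correct A c = bool-ext forth back
      where
      p′ : ℕ → Bool
      p′ m = (t A c ≡ᵇ m) ∧ P m A c
      forth : any p′ (upTo (suc (bound n))) ≡ true → P (t A c) A c ≡ true
      forth h with any-elim p′ (upTo (suc (bound n))) h
      ... | m , _ , hm with ∧-elim {t A c ≡ᵇ m} hm
      ... | t=m , Pm = subst (λ m → P m A c ≡ true) (sym (≡ᵇ-sound (t A c) m t=m)) Pm
      back : P (t A c) A c ≡ true → any p′ (upTo (suc (bound n))) ≡ true
      back h = any-intro p′ (∈-upTo⁺ (s≤s (bounded n A c))) (∧-intro (≡ᵇ-refl (t A c)) h)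

  N-map : ∀ {q ks t} (g : ℕ → ℕ) B → (n : Num q ks t) → (∀ m → m ≤ bound n → g m ≤ B) →
    Num q ks (λ A c → g (t A c))
  N-map {q} {ks} g B n g≤B = record
    { bound = B
    ; bounded = λ A c → g≤B _ (bounded n A c)
    ; at = λ m → N-bind n (λ i → D-const (g i ≡ᵇ m))
    }

  N-const : ∀ {q ks} m → Num q ks (λ _ _ → m)
  N-const {q} {ks} m = record { bound = m ; bounded = λ _ _ → ≤-refl ; at = λ i → D-const (m ≡ᵇ i) }

  N-+ : ∀ {q ks t u} → Num q ks t → Num q ks u → Num q ks (λ A c → t A c + u A c)
  N-+ {q} {ks} {t} {u} n n′ = record
    { bound = bound n + bound n′
    ; bounded = λ A c → +-mono-≤ (bounded n A c) (bounded n′ A c)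
    ; at = λ m → N-bind n λ i →
        N-bind n′ λ j → D-const (i + j ≡ᵇ m)
    }

  N-⟦⟧ : ∀ {q ks P} → Def q ks P → Num q ks (λ A c → ⟦ P A c ⟧)
  N-⟦⟧ {P = P} p = record
    { bound = 1
    ; bounded = λ A c → ⟦⟧≤1 (P A c)
    ; at = λ m → D-map (λ b → ⟦ b ⟧ ≡ᵇ m) p
    }
    where
    ⟦⟧≤1 : ∀ b → ⟦ b ⟧ ≤ 1
    ⟦⟧≤1 true = ≤-refl
    ⟦⟧≤1 false = z≤n

  -- The range is a fixed list, such as the number sort once s is fixed, so counting over it takes
  -- no quantifier.
  N-countL : ∀ {q ks} {B : Set} {P : B → Rel ks} (bs : List B) → (∀ b → Def q ks (P b)) →
    Num q ks (λ A c → countL (λ b → P b A c) bs)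
  N-countL [] p = N-const 0
  N-countL {P = P} (b ∷ bs) p = N-+ (N-⟦⟧ (p b)) (N-countL bs p)

  N-∑< : ∀ {q ks} {t : ℕ → Term ks} n → (∀ i → Num q ks (t i)) → Num q ks (λ A c → ∑< n (λ i → t i A c))
  N-∑< zero _ = N-const 0
  N-∑< {t = t} (suc n) ts = N-+ (N-∑< n ts) (ts n)

  -- Any variable outside `c` may be overwritten, since the context lists everything the formula
  -- refers to.
  D-count≥ : ∀ {q ks P} → suc (sum ks) ≤ K → Def q (1 ∷ ks) P → ∀ m →
    Def (suc q) ks (λ A c → m ≤ᵇ countL (λ v → P A (v ∷ [] , c)) (allFin s))
  D-count≥ {P = P} room p m .formula c with fresh (entries c) (subst (_< K) (sym (length-entries c)) room)
  ... | y , y∉ with p .formula (y ∷ [] , c)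
  ... | ψ , ψ≤q , h = exists≥ m y ψ , s≤s ψ≤q , λ A β →
    cong (m ≤ᵇ_) (countL-cong (λ v → trans (h A (β [ y ]≔ v))
      (cong (P A) (cong₂ (λ x c′ → (x ∷ [] , c′)) (V.lookup∘update y β v)
        (mapC-agree c λ x x∈ → V.lookup∘update′ (λ x≡y → y∉ (subst (_∈ entries c) x≡y x∈)) β v)))) (allFin s))

  N-count₁ : ∀ {q ks P} → suc (sum ks) ≤ K → Def q (1 ∷ ks) P →
    Num (suc q) ks (λ A c → countL (λ v → P A (v ∷ [] , c)) (allFin s))
  N-count₁ {P = P} room p = record
    { bound = length (allFin s)
    ; bounded = λ A c → countL≤length _ (allFin s)
    ; at = λ m → D-ext (λ A c → ≤ᵇ-between (count A c) m)
        (D-and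
          (D-count≥ room p m)
          (D-not (D-count≥ room p (suc m))))
    }
    where
    count : Term _
    count A c = countL (λ v → P A (v ∷ [] , c)) (allFin s)

  -- Σ_v t(v) is computed from the counts #{v : t(v) > i}.
  N-∑₁ : ∀ {q ks t} → suc (sum ks) ≤ K → Num q (1 ∷ ks) t →
    Num (suc q) ks (λ A c → ∑ (λ v → t A (v ∷ [] , c)) (allFin s))
  N-∑₁ {q} {ks} {t} room n = N-ext layers (N-∑< (bound n) λ i →
    N-count₁ room
      (N-bind n λ m → D-const (suc i ≤ᵇ m)))
    where
    layers : ∀ A c → ∑< (bound n) (λ i → countL (λ v → suc i ≤ᵇ t A (v ∷ [] , c)) (allFin s)) ≡
                     ∑ (λ v → t A (v ∷ [] , c)) (allFin s)
    layers A c = begin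
      ∑< (bound n) (λ i → countL (λ v → suc i ≤ᵇ t A (v ∷ [] , c)) (allFin s))
        ≡⟨ ∑<-cong (bound n) (λ i → countL-∑ (λ v → suc i ≤ᵇ t A (v ∷ [] , c)) (allFin s)) ⟩
      ∑< (bound n) (λ i → ∑ (λ v → ⟦ suc i ≤ᵇ t A (v ∷ [] , c) ⟧) (allFin s))
        ≡⟨ ∑<-∑-swap (bound n) (λ i v → ⟦ suc i ≤ᵇ t A (v ∷ [] , c) ⟧) (allFin s) ⟩
      ∑ (λ v → ∑< (bound n) (λ i → ⟦ suc i ≤ᵇ t A (v ∷ [] , c) ⟧)) (allFin s)
        ≡⟨ ∑-cong (λ v → ∑<-<ᵇ (bound n) (bounded n A (v ∷ [] , c))) (allFin s) ⟩
      ∑ (λ v → t A (v ∷ [] , c)) (allFin s) ∎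
      where open ≡-Reasoning

  -- Counting quantifiers bind single elements; a count of tuples is the sum, over the first entry,
  -- of the counts of the remaining entries.
  N-count : ∀ k {q ks P} → k + sum ks ≤ K → Def q (k ∷ ks) P →
    Num (k + q) ks (λ A c → countL (λ w → P A (w , c)) (tuples s k))
  N-count zero {P = P} room p =
    N-ext (λ A c → sym (+-identityʳ ⟦ P A ([] , c) ⟧))
      (N-⟦⟧ (D-rename (λ c → [] , c) (λ _ _ → refl) p))
  N-count (suc k) {q} {ks} {P} room p =
    N-ext (λ A c → sym (split A c))
      (N-∑₁
        (≤-trans (s≤s (m≤n+m (sum ks) k)) room)
        (N-count k {P = λ A c → P A (push c)} (subst (_≤ K) (sym (+-suc k (sum ks))) room)
          (D-rename push (λ { f (w , v ∷ [] , c) → refl }) p)))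
    where
    push : ∀ {X} → Ctx X (k ∷ 1 ∷ ks) → Ctx X (suc k ∷ ks)
    push (w , v , c) = head v ∷ w , c
    split : ∀ A c → countL (λ w → P A (w , c)) (tuples s (suc k)) ≡
                    ∑ (λ v → countL (λ w → P A (v ∷ w , c)) (tuples s k)) (allFin s)
    split A c = begin
      countL (λ w → P A (w , c)) (tuples s (suc k))
        ≡⟨ countL-∑ (λ w → P A (w , c)) (tuples s (suc k)) ⟩
      ∑ (λ w → ⟦ P A (w , c) ⟧) (tuples s (suc k))
        ≡⟨ ∑-concatMap (λ w → ⟦ P A (w , c) ⟧) (λ v → L.map (v ∷_) (tuples s k)) (allFin s) ⟩
      ∑ (λ v → ∑ (λ w → ⟦ P A (w , c) ⟧) (L.map (v ∷_) (tuples s k))) (allFin s)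
        ≡⟨ ∑-cong (λ v → trans (∑-map (λ w → ⟦ P A (w , c) ⟧) (v ∷_) (tuples s k))
             (sym (countL-∑ (λ w → P A (v ∷ w , c)) (tuples s k)))) (allFin s) ⟩
      ∑ (λ v → countL (λ w → P A (v ∷ w , c)) (tuples s k)) (allFin s) ∎
      where open ≡-Reasoning

  D-anyTuple : ∀ k {q ks P} → k + sum ks ≤ K → Def q (k ∷ ks) P →
    Def (k + q) ks (λ A c → any (λ w → P A (w , c)) (tuples s k))
  D-anyTuple k {P = P} room p = D-ext (λ A c → sym (any-countL (λ w → P A (w , c)) (tuples s k)))
    (D-not (at (N-count k {P = P} room p) 0))

  D-vecEq : ∀ {q n ks} → Def q (n ∷ n ∷ ks) (λ _ (u , v , _) → vecEq u v)
  D-vecEq {n = n} .formula (xs , ys , _) = equal xs ys , equal-depth xs ys , λ A β → equal-correct A β xs ys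
    where
    equal : ∀ {n} → Vec (Fin K) n → Vec (Fin K) n → CF τ K
    equal [] [] = eq x₀ x₀
    equal (x ∷ xs) (y ∷ ys) = and (eq x y) (equal xs ys)
    equal-depth : ∀ {n q} (xs ys : Vec (Fin K) n) → qdepth (equal xs ys) ≤ q
    equal-depth [] [] = z≤n
    equal-depth (x ∷ xs) (y ∷ ys) = equal-depth xs ys
    vecEq-∷ : ∀ {n} x y (u v : Vec (Fin s) n) → ⌊ x F.≟ y ⌋ ∧ vecEq u v ≡ vecEq (x ∷ u) (y ∷ v)
    vecEq-∷ x y u v = bool-ext forth back
      where
      forth : ⌊ x F.≟ y ⌋ ∧ vecEq u v ≡ true → vecEq (x ∷ u) (y ∷ v) ≡ true
      forth h with ∧-elim h
      ... | x=y , u=v = subst (λ w → vecEq (x ∷ u) w ≡ true)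
        (cong₂ _∷_ (toWitness {a? = x F.≟ y} (subst B.T (sym x=y) _)) (vecEq-sound u v u=v)) (vecEq-refl (x ∷ u))
      back : vecEq (x ∷ u) (y ∷ v) ≡ true → ⌊ x F.≟ y ⌋ ∧ vecEq u v ≡ true
      back h with vecEq-sound (x ∷ u) (y ∷ v) h
      ... | refl = ∧-intro (≟-refl x) (vecEq-refl u)
    equal-correct : ∀ A β {n} (xs ys : Vec (Fin K) n) →
      ceval A (equal xs ys) β ≡ vecEq (V.map (lookup β) xs) (V.map (lookup β) ys)
    equal-correct A β [] [] = ≟-refl (lookup β x₀)
    equal-correct A β (x ∷ xs) (y ∷ ys) =
      trans (cong (_ ∧_) (equal-correct A β xs ys)) (vecEq-∷ (lookup β x) (lookup β y) _ _)

-- Formulas for the certificates and their quantifier depth.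

module DefinableRecursion (τ : Vocab) (s K : ℕ) (x₀ : Fin K) (d k ℓ q₀ t₀ M : ℕ)
  (eqR ER : Structure τ s → Ctx (Fin s) (k ∷ k ∷ d ∷ []) → Bool)
  (CR : Vec (Fin (suc s)) ℓ → Structure τ s → Ctx (Fin s) (k ∷ d ∷ []) → Bool)
  (eqD : Definability.Def τ s K x₀ q₀ (k ∷ k ∷ d ∷ []) eqR)
  (ED : Definability.Def τ s K x₀ q₀ (k ∷ k ∷ d ∷ []) ER)
  (CD : (is : Vec (Fin (suc s)) ℓ) → Definability.Def τ s K x₀ q₀ (k ∷ d ∷ []) (CR is))
  -- The widest contexts hold four k-tuples besides the parameters: a path from `u` to `v` with an
  -- edge `w`, `w′` on it, or `u` and `v` with members `u′` and `v′` of their classes.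
  (room₄ : sum (k ∷ k ∷ k ∷ k ∷ d ∷ []) ≤ K)
  (T≤2^t₀ : length (tuples s k) ≤ 2 ^ t₀) where

  open Definability τ s K x₀
  open Num

  module Sem (A : Structure τ s) (α : Vec (Fin s) d) where
    eq′ E′ : Vec (Fin s) k → Vec (Fin s) k → Bool
    eq′ u v = eqR A (u , v , α , tt)
    E′ u v = ER A (u , v , α , tt)
    C′ : Vec (Fin s) k → Vec (Fin (suc s)) ℓ → Bool
    C′ u is = CR is A (u , α , tt)
    open LRecSem s k ℓ eq′ E′ C′ public
    open Quotient s k ℓ eq′ E′ C′ public
    open Certificates s k ℓ M eq′ E′ C′ public
  open Sem

  room₃ : sum (k ∷ k ∷ k ∷ d ∷ []) ≤ K
  room₃ = ≤-trans (m≤n+m _ k) room₄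

  room₂ : sum (k ∷ k ∷ d ∷ []) ≤ K
  room₂ = ≤-trans (m≤n+m _ k) room₃

  doubleDepth : ℕ → ℕ
  doubleDepth zero = q₀
  doubleDepth (suc t) = k + doubleDepth t

  doubleD : ∀ t → Def (doubleDepth t) (k ∷ k ∷ d ∷ []) (λ A (u , v , α , _) → double A α t u v)
  doubleD zero = D-or D-vecEq (D-or eqD (D-rename (λ (u , v , α) → v , u , α) (λ _ _ → refl) eqD))
  doubleD (suc t) = D-anyTuple k room₃ (D-and
    (D-rename (λ (w , u , v , α) → u , w , α) (λ _ _ → refl) (doubleD t))
    (D-rename (λ (w , u , v , α) → w , v , α) (λ _ _ → refl) (doubleD t)))

  qₛ qₑ qₙ : ℕ
  qₛ = doubleDepth t₀
  qₑ = k + (k + qₛ)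
  qₙ = k + qₑ

  q₀≤qₛ : q₀ ≤ qₛ
  q₀≤qₛ = go t₀
    where
    go : ∀ t → q₀ ≤ doubleDepth t
    go zero = ≤-refl
    go (suc t) = ≤-trans (go t) (m≤n+m _ k)

  qₑ≤qₙ : qₑ ≤ qₙ
  qₑ≤qₙ = m≤n+m qₑ k

  k+qₛ≤qₑ : k + qₛ ≤ qₑ
  k+qₛ≤qₑ = m≤n+m (k + qₛ) k

  simD : Def qₛ (k ∷ k ∷ d ∷ []) (λ A (u , v , α , _) → sim A α u v)
  simD = D-ext (λ A (u , v , α , _) → double≡sim A α t₀ T≤2^t₀ u v) (doubleD t₀)

  edgeD : Def qₑ (k ∷ k ∷ d ∷ []) (λ A (u , v , α , _) → edgeG A α u v)
  edgeD = D-anyTuple k room₃ (D-and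
    (D-weaken (m≤n+m qₛ k) (D-rename (λ (u′ , u , v , α) → u , u′ , α) (λ _ _ → refl) simD))
    (D-anyTuple k room₄ (D-and
      (D-rename (λ (v′ , u′ , u , v , α) → v , v′ , α) (λ _ _ → refl) simD)
      (D-weaken q₀≤qₛ (D-rename (λ (v′ , u′ , u , v , α) → u′ , v′ , α) (λ _ _ → refl) ED)))))

  classSizeN : Num (k + qₛ) (k ∷ d ∷ []) (λ A (u , α , _) → classSize A α u)
  classSizeN = N-count k room₂ (D-rename (λ (w , u , α) → u , w , α) (λ _ _ → refl) simD)

  countBySizeN : ∀ {q ks P} (r : ∀ {X} → Ctx X ks → Vec X d) →
    (∀ {X Y} (f : X → Y) c → r (mapC f c) ≡ V.map f (r c)) →
    k + sum ks ≤ K → k + qₛ ≤ q → Def q (k ∷ ks) P →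
    Num (k + q) ks (λ A c → countBySize A (r c) (λ w → P A (w , c)))
  countBySizeN {q} {ks} {P} r natural room q≥ p = N-∑< (length (tuples s k)) λ j →
    N-map (_/ suc j) (bound (ofSizeN j)) (ofSizeN j) (λ m m≤ → ≤-trans (m/n≤m m (suc j)) m≤)
    where
    withParameters : ∀ {X} → Ctx X (k ∷ ks) → Ctx X (k ∷ d ∷ [])
    withParameters (w , c) = w , r c , tt
    ofSizeN : ∀ j → Num (k + q) ks (λ A c → countL (ofSize A (r c) (λ w → P A (w , c)) (suc j)) (tuples s k))
    ofSizeN j = N-count k room (D-and p (D-weaken q≥
      (at (N-rename withParameters (λ f (w , c) → cong (λ α → V.map f w , α , tt) (natural f c)) classSizeN) (suc j))))

  indegN : Num qₙ (k ∷ d ∷ []) (λ A (v , α , _) → indeg A α v)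
  indegN = N-ext (λ A (v , α , _) → countBySize≡countClasses A α (λ w → edgeG A α w v) (λ h → edgeG-congˡ A α h v))
    (countBySizeN (λ (v , α , _) → α) (λ _ _ → refl) room₂ k+qₛ≤qₑ edgeD)

  nextN : ∀ j → Num qₙ (k ∷ d ∷ []) (λ A (v , α , _) → next A α j v)
  nextN j = N-map (divOr0 j) j indegN (λ m _ → divOr0-≤ j m)

  inCD : ∀ j → Def (k + qₛ) (k ∷ d ∷ []) (λ A (u , α , _) → inC A α u j)
  inCD j = D-any (tuples (suc s) ℓ) λ is → D-and (D-const (encode is ≡ᵇ j))
    (D-anyTuple k room₂ (D-and
      (D-rename (λ (u′ , u , α) → u , u′ , α) (λ _ _ → refl) simD)
      (D-weaken q₀≤qₛ (D-rename (λ (u′ , u , α) → u′ , α) (λ _ _ → refl) (CD is)))))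

  localCheckD : ∀ {q} (W : Bool → Rel (k ∷ k ∷ k ∷ d ∷ [])) → (∀ x → Def q (k ∷ k ∷ k ∷ d ∷ []) (W x)) →
    qₙ ≤ q → ∀ y → Def (k + q) (k ∷ k ∷ d ∷ [])
      (λ A (w , w′ , α , _) → localCheck A α (λ x e → W x A (e , w , w′ , α , tt)) w y)
  localCheckD {q} W WD qₙ≤q y = D-and
    (D-not (D-anyTuple k room₃ (D-and childD (D-not (D-or (WD true) (WD false))))))
    (D-map (_== y) (N-bind
      (countBySizeN (λ (w , w′ , α , _) → α) (λ _ _ → refl) room₃ (≤-trans k+qₛ≤qₑ qₑ≤q) (D-and childD (WD true)))
      (λ m → D-weaken (≤-trans (≤-trans k+qₛ≤qₑ qₑ≤q) (m≤n+m q k))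
        (D-rename (λ (w , w′ , α) → w , α) (λ _ _ → refl) (inCD m)))))
    where
    qₑ≤q : qₑ ≤ q
    qₑ≤q = ≤-trans qₑ≤qₙ qₙ≤q
    childD : Def q (k ∷ k ∷ k ∷ d ∷ []) (λ A (e , w , w′ , α , _) → edgeG A α w e)
    childD = D-weaken qₑ≤q (D-rename (λ (e , w , w′ , α) → w , e , α) (λ _ _ → refl) edgeD)

  nodeCheckD : ∀ {q} (U : Bool → ℕ → Rel (k ∷ d ∷ [])) → (∀ x i → Def q (k ∷ d ∷ []) (U x i)) →
    qₙ ≤ q → ∀ y j → Def (k + q) (k ∷ d ∷ [])
      (λ A (w , α , _) → nodeCheck A α (λ x i u → U x i A (u , α , tt)) y j w)
  nodeCheckD U UD qₙ≤q y zero = D-const (not y)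
  -- No child is assumed here, so `w` itself fills the slot of `w′`.
  nodeCheckD U UD qₙ≤q y (suc j) = D-rename (λ (w , α) → w , w , α) (λ _ _ → refl)
    (localCheckD (λ x A (e , w , w′ , α , _) → U x (next A α j e) A (e , α , tt))
      (λ x → N-bind (N-weaken qₙ≤q (N-rename (λ (e , w , w′ , α) → e , α) (λ _ _ → refl) (nextN j)))
        (λ m → D-rename (λ (e , w , w′ , α) → e , α) (λ _ _ → refl) (UD x m)))
      qₙ≤q y)

  throughNodeD : ∀ {q} (R : Bool → ℕ → Bool → ℕ → Rel (k ∷ k ∷ d ∷ [])) (U : Bool → ℕ → Rel (k ∷ d ∷ [])) →
    (∀ x i y j → Def q (k ∷ k ∷ d ∷ []) (R x i y j)) → (∀ x i → Def q (k ∷ d ∷ []) (U x i)) →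
    qₙ ≤ q → ∀ x i → Def (k + (k + q)) (k ∷ d ∷ [])
      (λ A (u , α , _) → throughNode A α (λ x i y j u v → R x i y j A (u , v , α , tt)) (λ x i u → U x i A (u , α , tt)) x i u)
  throughNodeD {q} R U RD UD qₙ≤q x i =
    D-any (true ∷ false ∷ []) λ y → D-any (upTo (suc M)) λ j → D-anyTuple k room₂ (D-and
      (D-weaken (m≤n+m q k) (D-rename (λ (w , u , α) → u , w , α) (λ _ _ → refl) (RD x i y j)))
      (D-rename (λ (w , u , α) → w , α) (λ _ _ → refl) (nodeCheckD U UD qₙ≤q y j)))

  assumingD : ∀ {q} (U : Bool → ℕ → Rel (k ∷ d ∷ [])) → (∀ x i → Def q (k ∷ d ∷ []) (U x i)) →
    qₙ ≤ q → ∀ z l x → Def q (k ∷ k ∷ k ∷ d ∷ [])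
      (λ A (e , w , w′ , α , _) → assuming A α z w′ (λ b e → U b (next A α l e) A (e , α , tt)) x e)
  assumingD U UD qₙ≤q z l x = D-if
    (D-weaken (≤-trans (m≤n+m qₛ k) (≤-trans k+qₛ≤qₑ (≤-trans qₑ≤qₙ qₙ≤q)))
      (D-rename (λ (e , w , w′ , α) → e , w′ , α) (λ _ _ → refl) simD))
    (D-const (x == z))
    (D-rename (λ (e , w , w′ , α) → e , α) (λ _ _ → refl)
      (N-bind (N-weaken qₙ≤q (nextN l)) (UD x)))

  viaD : ∀ {q} (R : Bool → ℕ → Bool → ℕ → Rel (k ∷ k ∷ d ∷ [])) (U : Bool → ℕ → Rel (k ∷ d ∷ [])) →
    (∀ x i y j → Def q (k ∷ k ∷ d ∷ []) (R x i y j)) → (∀ x i → Def q (k ∷ d ∷ []) (U x i)) →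
    qₙ ≤ q → ∀ x i y j z z′ l → Def (k + q) (k ∷ k ∷ k ∷ k ∷ d ∷ [])
      (λ A (w′ , w , u , v , α , _) →
        via A α (λ x i y j u v → R x i y j A (u , v , α , tt)) (λ x i u → U x i A (u , α , tt)) x i y j z z′ l u v w w′)
  viaD {q} R U RD UD qₙ≤q x i y j z z′ l = D-and
    (D-weaken (m≤n+m q k) (D-and
      (D-rename (λ (w′ , w , u , v , α) → u , w , α) (λ _ _ → refl) (RD x i z (suc l)))
      (D-rename (λ (w′ , w , u , v , α) → w′ , v , α) (λ _ _ → refl)
        (N-bind (N-weaken qₙ≤q (N-rename (λ (w′ , v , α) → w′ , α) (λ _ _ → refl) (nextN l)))
          (λ m → RD z′ m y j)))))
    (D-rename (λ (w′ , w , u , v , α) → w , w′ , α) (λ _ _ → refl) (D-and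
      (D-weaken (≤-trans qₑ≤qₙ (≤-trans qₙ≤q (m≤n+m q k))) edgeD)
      (localCheckD (λ x A (e , w , w′ , α , _) → assuming A α z′ w′ (λ b e → U b (next A α l e) A (e , α , tt)) x e)
        (assumingD U UD qₙ≤q z′ l) qₙ≤q z)))

  throughEdgeD : ∀ {q} (R : Bool → ℕ → Bool → ℕ → Rel (k ∷ k ∷ d ∷ [])) (U : Bool → ℕ → Rel (k ∷ d ∷ [])) →
    (∀ x i y j → Def q (k ∷ k ∷ d ∷ []) (R x i y j)) → (∀ x i → Def q (k ∷ d ∷ []) (U x i)) →
    qₙ ≤ q → ∀ x i y j → Def (k + (k + (k + q))) (k ∷ k ∷ d ∷ [])
      (λ A (u , v , α , _) →
        throughEdge A α (λ x i y j u v → R x i y j A (u , v , α , tt)) (λ x i u → U x i A (u , α , tt)) x i y j u v)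
  throughEdgeD R U RD UD qₙ≤q x i y j =
    D-any (true ∷ false ∷ []) λ z → D-any (true ∷ false ∷ []) λ z′ → D-any (upTo M) λ l →
      D-anyTuple k room₃ (D-anyTuple k room₄ (viaD R U RD UD qₙ≤q x i y j z z′ l))

  -- Each round spends `2 * k` on `valued (suc t)`, and `implied (suc t)` spends `3 * k` on top of
  -- that: one block for each end of the edge and one for the local check. The start `qₙ` leaves
  -- room for the in-degrees in every round.
  depth : ℕ → ℕ
  depth zero = qₙ
  depth (suc t) = k + (k + (k + (k + (k + depth t))))

  qₙ≤depth : ∀ t → qₙ ≤ depth t
  qₙ≤depth zero = ≤-refl
  qₙ≤depth (suc t) = ≤-trans (qₙ≤depth t)
    (≤-trans (m≤n+m _ k) (≤-trans (m≤n+m _ k) (≤-trans (m≤n+m _ k) (≤-trans (m≤n+m _ k) (m≤n+m _ k)))))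

  mutual
    valuedD : ∀ t x i → Def (depth t) (k ∷ d ∷ []) (λ A (u , α , _) → valued A α t x i u)
    valuedD zero x i = D-const ((i ≡ᵇ 0) ∧ not x)
    valuedD (suc t) x i = D-weaken (≤-trans (m≤n+m _ k) (≤-trans (m≤n+m _ k) (m≤n+m _ k))) (valuedSucD t x i)

    valuedSucD : ∀ t x i → Def (k + (k + depth t)) (k ∷ d ∷ []) (λ A (u , α , _) → valued A α (suc t) x i u)
    valuedSucD t = throughNodeD _ _ (impliedD t) (valuedD t) (qₙ≤depth t)

    impliedD : ∀ t x i y j → Def (depth t) (k ∷ k ∷ d ∷ []) (λ A (u , v , α , _) → implied A α t x i y j u v)
    impliedD zero x i y j = D-and (D-const (x == y)) (D-and (D-const (i ≡ᵇ j))
      (D-weaken (≤-trans (m≤n+m qₛ k) (≤-trans k+qₛ≤qₑ qₑ≤qₙ)) simD))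
    impliedD (suc t) x i y j = D-or
      (D-weaken (≤-trans lower (≤-trans (m≤n+m _ k) (≤-trans (m≤n+m _ k) (m≤n+m _ k)))) (impliedD t x i y j))
      (throughEdgeD _ _ (λ x i y j → D-weaken lower (impliedD t x i y j)) (valuedSucD t)
        (≤-trans (qₙ≤depth t) lower) x i y j)
      where
      lower : depth t ≤ k + (k + depth t)
      lower = ≤-trans (m≤n+m _ k) (m≤n+m _ k)

  doubleDepth≡ : ∀ t → doubleDepth t ≡ t * k + q₀
  doubleDepth≡ zero = refl
  doubleDepth≡ (suc t) = trans (cong (k +_) (doubleDepth≡ t)) (sym (+-assoc k (t * k) q₀))

  depth≡ : ∀ t → depth t ≡ t * (5 * k) + (3 * k + (t₀ * k + q₀))
  depth≡ zero = trans (three k qₛ) (cong (3 * k +_) (doubleDepth≡ t₀))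
    where
    three : ∀ k n → k + (k + (k + n)) ≡ 3 * k + n
    three = solve-∀
  depth≡ (suc t) = trans (five k (depth t))
    (trans (cong (5 * k +_) (depth≡ t)) (sym (+-assoc (5 * k) (t * (5 * k)) _)))
    where
    five : ∀ k n → k + (k + (k + (k + (k + n)))) ≡ 5 * k + n
    five = solve-∀

  XD : ∀ t i → i ≤ M → length (tuples s k) * (i * i) < 2 ^ t →
    Def (depth t) (k ∷ d ∷ []) (λ A (u , α , _) → X A α u i)
  XD t i i≤M small = D-ext (λ A (u , α , _) → valued≡X A α t i u i≤M (≤-<-trans (size-bound A α i u) small))
    (valuedD t true i)

-- Induction on LREC formulas.

-- L is any number with s < 2 ^ L, so that a * L is O(log s).
record LogDefinable {τ : Vocab} {d n : ℕ} (φ : LF τ d n) : Set where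
  field
    width : ℕ
    slope : ℕ
    definable : ∀ {K} (x₀ : Fin K) → width ≤ K → ∀ {s L} → 1 ≤ L → s < 2 ^ L → (β : Vec (Fin (suc s)) n) →
      Definability.Def τ s K x₀ (slope * L) (d ∷ []) (λ A (α , _) → eval A φ α β)
open LogDefinable

module _ {τ : Vocab} where

  constant : ∀ {d n} {φ : LF τ d n} (b : ∀ {s} → Vec (Fin (suc s)) n → Bool) →
    (∀ {s} (A : Structure τ s) α β → b β ≡ eval A φ α β) → LogDefinable φ
  constant b correct = record { width = 0 ; slope = 0 ; definable = λ {K} x₀ _ {s} _ _ β →
    let open Definability τ s K x₀ in D-ext (λ A (α , _) → correct A α β) (D-const (b β)) }

  atomic-rel : ∀ {d n} R xs → LogDefinable {τ} {d} {n} (rel R xs)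
  atomic-rel R xs = record { width = 0 ; slope = 0 ; definable = λ {K} x₀ _ {s} _ _ β →
    record { formula = λ (ys , _) → rel R (map (lookup ys) xs) , z≤n , λ A γ → cong (relA A R) (begin
      map (lookup γ) (map (lookup ys) xs)       ≡⟨ V.map-∘ (lookup γ) (lookup ys) xs ⟨
      map (λ x → lookup γ (lookup ys x)) xs     ≡⟨ V.map-cong (λ x → sym (V.lookup-map x (lookup γ) ys)) xs ⟩
      map (lookup (map (lookup γ) ys)) xs       ∎) } }
    where open ≡-Reasoning

  atomic-deq : ∀ {d n} x y → LogDefinable {τ} {d} {n} (deq x y)
  atomic-deq x y = record { width = 0 ; slope = 0 ; definable = λ {K} x₀ _ {s} _ _ β →
    record { formula = λ (ys , _) → eq (lookup ys x) (lookup ys y) , z≤n , λ A γ →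
      cong₂ (λ u v → ⌊ u F.≟ v ⌋) (sym (V.lookup-map x (lookup γ) ys)) (sym (V.lookup-map y (lookup γ) ys)) } }

  slope≤ : ∀ a a′ L → a * L ≤ (a + a′) * L
  slope≤ a a′ L = *-monoˡ-≤ L (m≤m+n a a′)

  slope≤′ : ∀ a a′ L → a′ * L ≤ (a + a′) * L
  slope≤′ a a′ L = *-monoˡ-≤ L (m≤n+m a′ a)

  negation : ∀ {d n} {φ : LF τ d n} → LogDefinable φ → LogDefinable (lnot φ)
  negation p = record { width = width p ; slope = slope p ; definable = λ {K} x₀ w {s} L≥1 s< β →
    let open Definability τ s K x₀ in D-not (definable p x₀ w L≥1 s< β) }

  binary : ∀ {d n} {φ φ′ χ : LF τ d n} (_⊙_ : Bool → Bool → Bool) →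
    (∀ {s} (A : Structure τ s) α β → eval A φ α β ⊙ eval A φ′ α β ≡ eval A χ α β) →
    LogDefinable φ → LogDefinable φ′ → LogDefinable χ
  binary {φ = φ} {φ′} _⊙_ correct p p′ = record
    { width = width p + width p′
    ; slope = slope p + slope p′
    ; definable = λ {K} x₀ w {s} {L} L≥1 s< β →
        let open Definability τ s K x₀
            q = D-weaken (slope≤ (slope p) (slope p′) L) (definable p x₀ (≤-trans (m≤m+n _ (width p′)) w) L≥1 s< β)
            q′ = D-weaken (slope≤′ (slope p) (slope p′) L) (definable p′ x₀ (≤-trans (m≤n+m _ (width p)) w) L≥1 s< β)
        in D-ext (λ A (α , _) → trans (if-⊙ (eval A φ α β) (eval A φ′ α β)) (correct A α β))
             (D-if q (D-map (true ⊙_) q′) (D-map (false ⊙_) q′))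
    }
    where
    if-⊙ : ∀ a b → (if a then true ⊙ b else false ⊙ b) ≡ a ⊙ b
    if-⊙ true b = refl
    if-⊙ false b = refl

  countingElements : ∀ {d n} {φ : LF τ (suc d) n} {χ : LF τ d n} (g : ∀ {s} → Vec (Fin (suc s)) n → ℕ → Bool) →
    (∀ {s} (A : Structure τ s) α β → g β (countL (λ v → eval A φ (v ∷ α) β) (allFin s)) ≡ eval A χ α β) →
    LogDefinable φ → LogDefinable χ
  countingElements {d} g correct p = record
    { width = suc (d + 0) + width p
    ; slope = suc (slope p)
    ; definable = λ {K} x₀ w {s} {L} L≥1 s< β →
        let open Definability τ s K x₀
            q = D-rename {ks′ = 1 ∷ d ∷ []} (λ (v , α , _) → head v ∷ α , tt) (λ { f (v ∷ [] , α , _) → refl })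
                  (definable p x₀ (≤-trans (m≤n+m _ (suc (d + 0))) w) L≥1 s< β)
        in D-ext (λ A (α , _) → correct A α β)
             -- The additional quantifier is paid for by one more `L`, as `1 ≤ L`.
             (D-weaken (+-monoˡ-≤ (slope p * L) L≥1)
               (N-bind (N-count₁ (≤-trans (m≤m+n (suc (d + 0)) _) w) q) (λ m → D-const (g β m))))
    }

  countingNumbers : ∀ {d n} {φ : LF τ d (suc n)} {χ : LF τ d n} (g : ∀ {s} → Vec (Fin (suc s)) n → ℕ → Bool) →
    (∀ {s} (A : Structure τ s) α β → g β (countL (λ i → eval A φ α (i ∷ β)) (allFin (suc s))) ≡ eval A χ α β) →
    LogDefinable φ → LogDefinable χ
  countingNumbers g correct p = record
    { width = width p
    ; slope = slope p
    ; definable = λ {K} x₀ w {s} L≥1 s< β →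
        let open Definability τ s K x₀
        in D-ext (λ A (α , _) → correct A α β)
             (N-bind (N-countL (allFin (suc s)) (λ i → definable p x₀ w L≥1 s< (i ∷ β))) (λ m → D-const (g β m)))
    }

  recursion : ∀ {d n} k ℓ m {φ= φE : LF τ ((k + k) + d) n} {φC : LF τ (k + d) (suc ℓ + n)} xs κs →
    LogDefinable φ= → LogDefinable φE → LogDefinable φC → LogDefinable {n = n} (lrec k ℓ m φ= φE φC xs κs)
  recursion {d} {n} k ℓ m {φ=} {φE} {φC} xs κs p= pE pC = record
    { width = sum (k ∷ k ∷ k ∷ k ∷ d ∷ []) + (width p= + (width pE + width pC))
    ; slope = a + b
    ; definable = define
    }
    where
    a b c e : ℕ
    c = sum (k ∷ k ∷ k ∷ k ∷ d ∷ [])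
    a = slope p= + (slope pE + slope pC)
    -- There are at most `2 ^ (L * k)` tuples, and `i < 2 ^ (L * suc m)` enters `size-bound`
    -- squared; hence `L * e` rounds suffice.
    e = k + (suc m + suc m)
    -- `5 * k` for each of the `L * e` rounds, `3 * k` to get from `sim` to the in-degrees, and `k`
    -- for each of the `L * k` squarings.
    b = e * (5 * k) + (3 * k + k * k)
    define : ∀ {K} (x₀ : Fin K) → c + (width p= + (width pE + width pC)) ≤ K →
      ∀ {s L} → 1 ≤ L → s < 2 ^ L → (β : Vec (Fin (suc s)) n) →
      Definability.Def τ s K x₀ ((a + b) * L) (d ∷ []) (λ A (α , _) → eval A (lrec k ℓ m φ= φE φC xs κs) α β)
    define {K} x₀ w {s} {L} L≥1 s< β =
      D-rename (λ (α , _) → map (lookup α) xs , α , tt) (λ f (α , _) → cong (λ us → us , map f α , tt) (select f α))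
        (D-weaken depth≤ (XD (L * e) i ≤-refl small))
      where
      open Definability τ s K x₀
      i : ℕ
      i = encode (map (lookup β) κs)
      onPairs : ∀ {q φ} → Def q (((k + k) + d) ∷ []) (λ A (α , _) → eval A φ α β) →
        Def q (k ∷ k ∷ d ∷ []) (λ A (u , v , α , _) → eval A φ ((u V.++ v) V.++ α) β)
      onPairs = D-rename (λ (u , v , α , _) → (u V.++ v) V.++ α , tt) λ f (u , v , α , _) →
        cong (_, tt) (sym (trans (V.map-++ f (u V.++ v) α) (cong (V._++ map f α) (V.map-++ f u v))))
      w= : width p= ≤ K
      w= = ≤-trans (m≤m+n (width p=) (width pE + width pC)) (≤-trans (m≤n+m _ c) w)
      wE : width pE ≤ K
      wE = ≤-trans (m≤m+n (width pE) (width pC)) (≤-trans (m≤n+m _ (width p=)) (≤-trans (m≤n+m _ c) w))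
      wC : width pC ≤ K
      wC = ≤-trans (m≤n+m (width pC) (width pE)) (≤-trans (m≤n+m _ (width p=)) (≤-trans (m≤n+m _ c) w))
      =D : Def (a * L) (k ∷ k ∷ d ∷ []) (λ A (u , v , α , _) → eval A φ= ((u V.++ v) V.++ α) β)
      =D = onPairs {φ = φ=} (D-weaken (slope≤ (slope p=) (slope pE + slope pC) L) (definable p= x₀ w= L≥1 s< β))
      ED : Def (a * L) (k ∷ k ∷ d ∷ []) (λ A (u , v , α , _) → eval A φE ((u V.++ v) V.++ α) β)
      ED = onPairs {φ = φE} (D-weaken
        (≤-trans (slope≤ (slope pE) (slope pC) L) (slope≤′ (slope p=) (slope pE + slope pC) L))
        (definable pE x₀ wE L≥1 s< β))
      CD : (is : Vec (Fin (suc s)) (suc ℓ)) → Def (a * L) (k ∷ d ∷ []) (λ A (u , α , _) → eval A φC (u V.++ α) (is V.++ β))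
      CD is = D-rename (λ (u , α , _) → u V.++ α , tt) (λ f (u , α , _) → cong (_, tt) (sym (V.map-++ f u α)))
        (D-weaken (≤-trans (slope≤′ (slope pE) (slope pC) L) (slope≤′ (slope p=) (slope pE + slope pC) L))
          (definable pC x₀ wC L≥1 s< (is V.++ β)))
      T≤ : length (tuples s k) ≤ 2 ^ (L * k)
      T≤ = begin
        length (tuples s k)   ≡⟨ length-tuples s k ⟩
        s ^ k                 ≤⟨ ^-monoˡ-≤ k (<⇒≤ s<) ⟩
        (2 ^ L) ^ k           ≡⟨ ^-*-assoc 2 L k ⟩
        2 ^ (L * k)           ∎
        where open ≤-Reasoning
      -- Numbers never exceed the one at the root, so the bound `M` is `i` itself.
      open DefinableRecursion τ s K x₀ d k (suc ℓ) (a * L) (L * k) i _ _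
        (λ is A (u , α , _) → eval A φC (u V.++ α) (is V.++ β)) =D ED CD (≤-trans (m≤m+n c _) w) T≤
      i< : i < 2 ^ (L * suc m)
      i< = begin-strict
        i                     <⟨ encode< (map (lookup β) κs) ⟩
        suc s ^ suc m         ≤⟨ ^-monoˡ-≤ (suc m) s< ⟩
        (2 ^ L) ^ suc m       ≡⟨ ^-*-assoc 2 L (suc m) ⟩
        2 ^ (L * suc m)       ∎
        where open ≤-Reasoning
      small : length (tuples s k) * (i * i) < 2 ^ (L * e)
      small = begin-strict
        length (tuples s k) * (i * i)
          ≤⟨ *-monoˡ-≤ (i * i) T≤ ⟩
        2 ^ (L * k) * (i * i)
          <⟨ *-monoʳ-< (2 ^ (L * k)) {{m^n≢0 2 (L * k)}} (*-mono-< i< i<) ⟩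
        2 ^ (L * k) * (2 ^ (L * suc m) * 2 ^ (L * suc m))
          ≡⟨ cong (2 ^ (L * k) *_) (^-distribˡ-+-* 2 (L * suc m) (L * suc m)) ⟨
        2 ^ (L * k) * 2 ^ (L * suc m + L * suc m)
          ≡⟨ ^-distribˡ-+-* 2 (L * k) (L * suc m + L * suc m) ⟨
        2 ^ (L * k + (L * suc m + L * suc m))
          ≡⟨ cong (2 ^_) (factor L k (suc m)) ⟩
        2 ^ (L * e) ∎
        where
        open ≤-Reasoning
        factor : ∀ L k m → L * k + (L * m + L * m) ≡ L * (k + (m + m))
        factor = solve-∀
      depth≤ : depth (L * e) ≤ (a + b) * L
      depth≤ = begin
        depth (L * e)
          ≡⟨ depth≡ (L * e) ⟩
        L * e * (5 * k) + (3 * k + (L * k * k + a * L))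
          ≤⟨ +-monoʳ-≤ (L * e * (5 * k)) (+-monoˡ-≤ _
               (≤-trans (≤-reflexive (sym (*-identityʳ (3 * k)))) (*-monoʳ-≤ (3 * k) L≥1))) ⟩
        L * e * (5 * k) + (3 * k * L + (L * k * k + a * L))
          ≡⟨ collect L e k a ⟩
        (a + b) * L ∎
        where
        open ≤-Reasoning
        collect : ∀ L e k a → L * e * (5 * k) + (3 * k * L + (L * k * k + a * L)) ≡ (a + (e * (5 * k) + (3 * k + k * k))) * L
        collect = solve-∀
      select : ∀ {X Y : Set} (f : X → Y) (α : Vec X d) → map (lookup (map f α)) xs ≡ map f (map (lookup α) xs)
      select f α = trans (V.map-cong (λ x → V.lookup-map x f α) xs) (V.map-∘ f (lookup α) xs)

  logDefinable : ∀ {d n} (φ : LF τ d n) → LogDefinable φ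
  logDefinable (rel R xs) = atomic-rel R xs
  logDefinable (deq x y) = atomic-deq x y
  logDefinable (neq i j) = constant (λ β → ⌊ lookup β i F.≟ lookup β j ⌋) λ _ _ _ → refl
  logDefinable (nle i j) = constant (λ β → toℕ (lookup β i) ≤ᵇ toℕ (lookup β j)) λ _ _ _ → refl
  logDefinable (nsucc i j) = constant (λ β → suc (toℕ (lookup β i)) ≡ᵇ toℕ (lookup β j)) λ _ _ _ → refl
  logDefinable (nmin i) = constant (λ β → toℕ (lookup β i) ≡ᵇ 0) λ _ _ _ → refl
  logDefinable (nmax i) = constant (λ {s} β → toℕ (lookup β i) ≡ᵇ s) λ _ _ _ → refl
  logDefinable (lnot φ) = negation (logDefinable φ)
  logDefinable (land φ φ′) = binary _∧_ (λ _ _ _ → refl) (logDefinable φ) (logDefinable φ′)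
  logDefinable (lor φ φ′) = binary _∨_ (λ _ _ _ → refl) (logDefinable φ) (logDefinable φ′)
  logDefinable (exD φ) = countingElements (λ _ m → not (m ≡ᵇ 0))
    (λ {s} A α β → sym (any-countL (λ v → eval A φ (v ∷ α) β) (allFin s))) (logDefinable φ)
  logDefinable (exN φ) = countingNumbers (λ _ m → not (m ≡ᵇ 0))
    (λ {s} A α β → sym (any-countL (λ i → eval A φ α (i ∷ β)) (allFin (suc s)))) (logDefinable φ)
  logDefinable (cntD φ κ) = countingElements (λ β m → m ≡ᵇ toℕ (lookup β κ)) (λ _ _ _ → refl) (logDefinable φ)
  logDefinable (cntN φ κ) = countingNumbers (λ β m → m ≡ᵇ toℕ (lookup β κ)) (λ _ _ _ → refl) (logDefinable φ)
  logDefinable (lrec k ℓ m φ= φE φC xs κs) =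
    recursion k ℓ m xs κs (logDefinable φ=) (logDefinable φE) (logDefinable φC)

-- The logarithmic bound and the union over all sizes.

<2^suc-log : ∀ n → n < 2 ^ suc ⌊log₂ n ⌋
<2^suc-log n with n <? 2 ^ suc ⌊log₂ n ⌋
... | yes lt = lt
... | no ge = contradiction
  (subst (_≤ ⌊log₂ n ⌋) (⌊log₂[2^n]⌋≡n (suc ⌊log₂ n ⌋)) (⌊log₂⌋-mono-≤ (≮⇒≥ ge))) (<⇒≱ ≤-refl)

affine-isOLog : ∀ a → IsOLog (λ n → suc (a * suc ⌊log₂ n ⌋))
-- From 2 on the logarithm is at least 1 and absorbs the additive `suc a`.
affine-isOLog a = suc (a + a) , 2 , λ n 2≤n → bound ⌊log₂ n ⌋ (⌊log₂⌋-mono-≤ 2≤n)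
  where
  bound : ∀ l → 1 ≤ l → suc (a * suc l) ≤ suc (a + a) * l
  bound l 1≤l = begin
    suc (a * suc l)          ≡⟨ cong suc (*-suc a l) ⟩
    suc a + a * l            ≤⟨ +-monoˡ-≤ (a * l) (≤-trans (≤-reflexive (sym (*-identityʳ (suc a)))) (*-monoʳ-≤ (suc a) 1≤l)) ⟩
    suc a * l + a * l        ≡⟨ *-distribʳ-+ l (suc a) a ⟨
    suc (a + a) * l          ∎
    where open ≤-Reasoning

-- The formula depends on the size of the structure, which is determined by counting the domain.
module Assembly {τ : Vocab} {K : ℕ} (x₀ : Fin K) where

  disjunction : ∀ {B : Set} → (B → CF τ K) → List B → CF τ K
  disjunction ψ [] = neg (eq x₀ x₀)
  disjunction ψ (b ∷ bs) = or (ψ b) (disjunction ψ bs)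

  disjunction-depth : ∀ {B : Set} (ψ : B → CF τ K) {q} → (∀ b → qdepth (ψ b) ≤ q) → ∀ bs → qdepth (disjunction ψ bs) ≤ q
  disjunction-depth ψ ψ≤q [] = z≤n
  disjunction-depth ψ ψ≤q (b ∷ bs) = ⊔-lub (ψ≤q b) (disjunction-depth ψ ψ≤q bs)

  disjunction-correct : ∀ {B : Set} (ψ : B → CF τ K) {s} (A : Structure τ s) β bs →
    ceval A (disjunction ψ bs) β ≡ any (λ b → ceval A (ψ b) β) bs
  disjunction-correct ψ A β [] = cong not (≟-refl (lookup β x₀))
  disjunction-correct ψ A β (b ∷ bs) = cong (ceval A (ψ b) β ∨_) (disjunction-correct ψ A β bs)

  hasSize : ℕ → CF τ K
  hasSize s = and (exists≥ s x₀ (eq x₀ x₀)) (neg (exists≥ (suc s) x₀ (eq x₀ x₀)))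

  hasSize-correct : ∀ s {s′} (A : Structure τ s′) β → ceval A (hasSize s) β ≡ (s′ ≡ᵇ s)
  hasSize-correct s {s′} A β = trans (cong (λ n → (s ≤ᵇ n) ∧ not (suc s ≤ᵇ n)) count-all) (≤ᵇ-between s′ s)
    where
    count-all : countL (λ v → ⌊ lookup (β [ x₀ ]≔ v) x₀ F.≟ lookup (β [ x₀ ]≔ v) x₀ ⌋) (allFin s′) ≡ s′
    count-all = begin
      countL (λ v → ⌊ lookup (β [ x₀ ]≔ v) x₀ F.≟ lookup (β [ x₀ ]≔ v) x₀ ⌋) (allFin s′)
        ≡⟨ countL-cong (λ v → ≟-refl (lookup (β [ x₀ ]≔ v) x₀)) (allFin s′) ⟩
      countL (λ _ → true) (allFin s′)
        ≡⟨ trans (countL-∑ (λ _ → true) (allFin s′)) (∑-const 1 (allFin s′)) ⟩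
      length (allFin s′) * 1
        ≡⟨ *-identityʳ _ ⟩
      length (allFin s′)
        ≡⟨ L.length-tabulate {n = s′} (λ i → i) ⟩
      s′ ∎
      where open ≡-Reasoning

  bySize : ∀ N → (Fin (suc N) → CF τ K) → CF τ K
  bySize N ψ = disjunction (λ i → and (hasSize (toℕ i)) (ψ i)) (allFin (suc N))

  bySize-depth : ∀ N ψ q → (∀ i → qdepth (ψ i) ≤ q) → qdepth (bySize N ψ) ≤ suc q
  bySize-depth N ψ q ψ≤q = disjunction-depth _ (λ i → ⊔-lub (s≤s z≤n) (m≤n⇒m≤1+n (ψ≤q i))) (allFin (suc N))

  -- A disjunct meant for another size may be true in `A`, but its size test fails there.
  bySize-correct : ∀ N ψ (i : Fin (suc N)) (A : Structure τ (toℕ i)) β → ceval A (bySize N ψ) β ≡ ceval A (ψ i) β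
  bySize-correct N ψ i A β = trans (disjunction-correct _ A β (allFin (suc N))) (bool-ext forth back)
    where
    chosen : Fin (suc N) → Bool
    chosen j = ceval A (hasSize (toℕ j)) β ∧ ceval A (ψ j) β
    forth : any chosen (allFin (suc N)) ≡ true → ceval A (ψ i) β ≡ true
    forth h with any-elim chosen (allFin (suc N)) h
    ... | j , _ , hj with ∧-elim {ceval A (hasSize (toℕ j)) β} hj
    ... | size-j , ψj = subst (λ j → ceval A (ψ j) β ≡ true)
      (sym (F.toℕ-injective (≡ᵇ-sound (toℕ i) (toℕ j) (trans (sym (hasSize-correct (toℕ j) A β)) size-j)))) ψj
    back : ceval A (ψ i) β ≡ true → any chosen (allFin (suc N)) ≡ true
    back h = any-intro chosen (∈-allFin i)
      (∧-intro (trans (hasSize-correct (toℕ i) A β) (≡ᵇ-refl (toℕ i))) h)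

-- The number 1 + m, where m is read as an element of Fin s; the value for m ≥ s is never used.
numberIn : ∀ s {N} → Fin N → Fin (suc s)
numberIn s m with toℕ m <? s
... | yes m<s = F.suc (fromℕ< m<s)
... | no _ = F.zero

numberIn-inject≤ : ∀ {s N} (s≤N : s ≤ N) (m : Fin s) → numberIn s (inject≤ m s≤N) ≡ F.suc m
numberIn-inject≤ {s} s≤N m with toℕ (inject≤ m s≤N) <? s
... | yes m<s = cong F.suc (F.toℕ-injective (trans (F.toℕ-fromℕ< m<s) (F.toℕ-inject≤ m s≤N)))
... | no m≮s = contradiction (subst (_< s) (sym (F.toℕ-inject≤ m s≤N)) (F.toℕ<n m)) m≮s

theorem1 : (τ : Vocab) → 0 < nsym τ → {d n : ℕ} (φ : LF τ d n) →
    Σ ℕ λ k → Σ (d ≤ k) λ d≤k → Σ (ℕ → ℕ) λ f → IsOLog f ×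
    ((N : ℕ) → Σ (Vec (Fin N) n → CF τ k) λ ψ →
    ((ms : Vec (Fin N) n) → qdepth (ψ ms) ≤ f N) ×
    ((s : ℕ) → 1 ≤ s → (s≤N : s ≤ N) → (A : Structure τ s) →
    (v : Vec (Fin s) d) → (ms : Vec (Fin s) n) →
    (β : Vec (Fin s) k) → ((i : Fin d) → lookup β (inject≤ i d≤k) ≡ lookup v i) →
    eval A φ v (map F.suc ms) ≡ ceval A (ψ (map (λ j → inject≤ j s≤N) ms)) β))
theorem1 τ _ {d} {n} φ = K , d≤K , f , affine-isOLog (slope p) , λ N →
  (λ ms → bySize N (atSize N ms)) ,
  (λ ms → bySize-depth N (atSize N ms) _ (λ i → proj₁ (proj₂ (defines N ms i)))) ,
  correct N
  where
  p : LogDefinable φ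
  p = logDefinable φ
  K : ℕ
  -- The successor provides the variable `F.zero` for truth constants and size tests, even if `d`
  -- and the width are 0.
  K = suc (d + width p)
  d≤K : d ≤ K
  d≤K = m≤n⇒m≤1+n (m≤m+n d (width p))
  f : ℕ → ℕ
  -- The outer successor leaves room for the size test. The same `L = suc ⌊log₂ N ⌋` serves all
  -- sizes up to N.
  f N = suc (slope p * suc ⌊log₂ N ⌋)
  xs : Vec (Fin K) d
  xs = tabulate λ i → inject≤ i d≤K
  open Assembly {τ} {K} F.zero
  defines : ∀ N (ms : Vec (Fin N) n) (i : Fin (suc N)) → Σ (CF τ K) λ ψ → qdepth ψ ≤ slope p * suc ⌊log₂ N ⌋ ×
    (∀ (A : Structure τ (toℕ i)) β → ceval A ψ β ≡ eval A φ (map (lookup β) xs) (map (numberIn (toℕ i)) ms))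
  defines N ms i = Definability.Def.formula
    (definable p F.zero (m≤n⇒m≤1+n (m≤n+m (width p) d)) (s≤s z≤n)
      (≤-<-trans (F.toℕ≤pred[n] i) (<2^suc-log N)) (map (numberIn (toℕ i)) ms))
    (xs , tt)
  atSize : ∀ N → Vec (Fin N) n → Fin (suc N) → CF τ K
  atSize N ms i = proj₁ (defines N ms i)
  correct : ∀ N s → 1 ≤ s → (s≤N : s ≤ N) → (A : Structure τ s) → (v : Vec (Fin s) d) → (ms : Vec (Fin s) n) →
    (β : Vec (Fin s) K) → ((i : Fin d) → lookup β (inject≤ i d≤K) ≡ lookup v i) →
    eval A φ v (map F.suc ms) ≡ ceval A (bySize N (atSize N (map (λ j → inject≤ j s≤N) ms))) β
  correct N s _ s≤N A v ms β v-in-β = atIndex (fromℕ< (s≤s s≤N)) (F.toℕ-fromℕ< (s≤s s≤N))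
    where
    ms′ : Vec (Fin N) n
    ms′ = map (λ j → inject≤ j s≤N) ms
    numbers : map (numberIn s) ms′ ≡ map F.suc ms
    numbers = trans (sym (V.map-∘ (numberIn s) (λ j → inject≤ j s≤N) ms)) (V.map-cong (numberIn-inject≤ s≤N) ms)
    values : map (lookup β) xs ≡ v
    values = begin
      map (lookup β) xs                           ≡⟨ V.tabulate-∘ (lookup β) (λ i → inject≤ i d≤K) ⟨
      tabulate (λ i → lookup β (inject≤ i d≤K))   ≡⟨ V.tabulate-cong v-in-β ⟩
      tabulate (lookup v)                         ≡⟨ V.tabulate∘lookup v ⟩
      v                                           ∎
      where open ≡-Reasoning
    -- The size must have the form `toℕ i` to match a disjunct, so `s` is replaced by the value of
    -- its index.
    atIndex : (i : Fin (suc N)) → toℕ i ≡ s → eval A φ v (map F.suc ms) ≡ ceval A (bySize N (atSize N ms′)) β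
    atIndex i refl = sym (begin
      ceval A (bySize N (atSize N ms′)) β                              ≡⟨ bySize-correct N (atSize N ms′) i A β ⟩
      ceval A (atSize N ms′ i) β                                       ≡⟨ proj₂ (proj₂ (defines N ms′ i)) A β ⟩
      eval A φ (map (lookup β) xs) (map (numberIn (toℕ i)) ms′)        ≡⟨ cong₂ (eval A φ) values numbers ⟩
      eval A φ v (map F.suc ms)                                        ∎)
      where open ≡-Reasoning
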